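{- For every $\varepsilon > 0$ there exist $\ell_0$ and $n_0$ such that for all $\ell \ge \ell_0$ and $n \ge n_0$ with $n\ell$ an integer, $i(n, n\ell) \ge \left(\frac12 - \varepsilon\right) n \ell^2 \log \ell$.
   Context: For a family $\mathcal{F}$ of subsets of $[n]$, $i(\mathcal{F})$ is the number of unordered pairs of distinct sets in $\mathcal{F}$ that are incomparable (neither contains the other). $i(n,m)$ is the minimum of $i(\mathcal{F})$ over all families $\mathcal{F}$ of $m$ subsets of $[n]$. $\log$ denotes the binary logarithm. -}

module Defs where

open import Data.Nat using (ℕ; zero; suc; _+_; _*_; _∸_; _^_; _≤_; _<_; _≤ᵇ_)
open import Data.Nat.Properties using (_<?_)
open import Data.Fin using (Fin; toℕ)
open import Data.Fin.Subset using (Subset; _⊆_)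
open import Data.Fin.Subset.Properties using (_⊆?_)
open import Data.List using (List; length; filter; allFin; concatMap; map)
open import Data.Product using (_×_; _,_)
open import Data.Bool using (if_then_else_)
open import Relation.Nullary using (¬_; Dec; yes; no)
open import Relation.Nullary.Decidable using (¬?; _×-dec_)
open import Function.Definitions using (Injective)
open import Relation.Binary.PropositionalEquality using (_≡_)

Family : ℕ → ℕ → Set
Family n m = Fin m → Subset n

Distinct : ∀ {n m} → Family n m → Set
Distinct F = Injective _≡_ _≡_ F

Incomparable : ∀ {n} → Subset n → Subset n → Set
Incomparable A B = ¬ (A ⊆ B) × ¬ (B ⊆ A)

incomparable? : ∀ {n} (A B : Subset n) → Dec (Incomparable A B)
incomparable? A B = ¬? (A ⊆? B) ×-dec ¬? (B ⊆? A)

indexPairs : (m : ℕ) → List (Fin m × Fin m)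
indexPairs m = filter (λ p → toℕ (Data.Product.proj₁ p) <? toℕ (Data.Product.proj₂ p))
                      (concatMap (λ j → map (λ k → (j , k)) (allFin m)) (allFin m))

iF : ∀ {n m} → Family n m → ℕ
iF F = length (filter (λ p → incomparable? (F (Data.Product.proj₁ p)) (F (Data.Product.proj₂ p)))
                      (indexPairs _))

-- LogBound i m n a b  encodes the real inequality
--     i ≥ (1/2 - a/b) · (m²/n) · log₂(m/n)        (for n, m, b > 0)
-- i.e. i ≥ (1/2 - ε) n ℓ² log₂ ℓ with ℓ = m/n, ε = a/b.
-- Writing the coefficient as ± p/q with q = 2bn, p = |b - 2a| m², the inequality is
-- equivalent to  2^(i q) ≥ (m/n)^p  (coefficient ≥ 0), resp.  2^(i q) ≥ (n/m)^p
-- (coefficient < 0), which we cross-multiply to stay in ℕ.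
LogBound : ℕ → ℕ → ℕ → ℕ → ℕ → Set
LogBound i m n a b =
  if 2 * a ≤ᵇ b
  then m ^ ((b ∸ 2 * a) * (m * m)) ≤ 2 ^ (i * (2 * b * n)) * n ^ ((b ∸ 2 * a) * (m * m))
  else n ^ ((2 * a ∸ b) * (m * m)) ≤ 2 ^ (i * (2 * b * n)) * m ^ ((2 * a ∸ b) * (m * m))

{-# OPTIONS --safe #-}
{-
A family of m sets in which every set is incomparable to at most D others has many k-chains as long as
(k − 1) D < m. By convexity it then also has many r-blow-ups of k-chains: r-tuples T₁, …, T_k with every set
of Tᵢ inside every set of Tᵢ₊₁. Each coordinate is non-constant on at most one Tᵢ, so a cube of dimension d
contains at most ((k + 1) 2ʳ)ᵈ such configurations. For r large compared with log k, comparison with the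
trivial count mʳᵏ up to constants gives k log m ≤ (1 + o(1)) d, and hence D ≥ (1 − o(1)) m log(m/n) / n
when n = O(log m). If n is larger, sort the family by size and cut it into blocks; some block has its share of
the n levels or less, and as D is small compared with a block, almost all of it lies in the interval spanned
by its first and last set, to which the count applies. Removing sets of maximum degree one at a time sums
these bounds to (1/2 − o(1)) (m² / n) log(m/n) incomparable pairs.
-}
module Submission where

open import Defs
open import Level using (Level)
open import Data.Nat using (>-nonZero; NonZero; _%_; _*_; _+_; _/_; _<_; _^_; _∸_; _≤_; _≤ᵇ_; _⊔_; suc; s≤s; zero; z≤n; ℕ)
open import Data.Nat.Properties
open import Data.Nat.Tactic.RingSolver using (solve-∀)
open import Data.List using (List; []; _++_; _∷_; allFin; cartesianProductWith; concatMap; drop; filter; length; map; take)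
open import Data.List.Properties using (drop-[]; length-++-sucʳ; length-drop; length-map; length-tabulate; length-take)
open import Data.List.Membership.Propositional using (_∈_)
open import Data.List.Membership.Propositional.Properties using (∈-++⁺ʳ; ∈-++⁺ˡ; ∈-++⁻; ∈-cartesianProductWith⁺; ∈-filter⁻; ∈-∃++)
open import Data.List.Relation.Unary.All as All using (All; []; _∷_)
open import Data.List.Relation.Unary.Any using (here; there)
open import Data.List.Relation.Unary.AllPairs as AllPairs using (AllPairs; []; _∷_)
open import Data.List.Relation.Unary.Unique.Propositional using (Unique)
open import Data.Vec as Vec using (Vec; []; _∷_)
open import Data.Product using (_,_; _×_; proj₁; proj₂; Σ; ∃; ∃₂)
open import Data.Sum using (_⊎_; inj₁; inj₂)
open import Function using (_∘_)
open import Relation.Nullary using (contradiction; does; no; yes; ¬_)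
open import Relation.Binary.PropositionalEquality using (_≡_; cong; cong₂; module ≡-Reasoning; refl; setoid; subst; sym; trans)
open import Data.Bool as Bool using (false; if_then_else_; true)
open import Data.Fin using (Fin; toℕ)
open import Data.Fin.Subset using (Side; Subset; _∪_; _⊆_; inside; outside; ∣_∣; ⊤; ⊥)
open import Data.Fin.Subset.Properties using (_⊆?_; drop-∷-⊆; out⊆; p⊆q⇒∣p∣≤∣q∣; s⊆s; ∣p∣≤n; ⊆-max; ⊆-min; ⊆-refl; ⊆-trans)
open import Data.List.Relation.Unary.Unique.Propositional.Properties using (allFin⁺; filter⁺; map⁺)
open import Data.List.Relation.Binary.Permutation.Propositional using (_↭_; ↭-sym; ↭⇒↭ₛ)
open import Data.List.Relation.Binary.Permutation.Propositional.Properties using (shift; ↭-length; ∈-resp-↭)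
open import Data.List.Relation.Binary.Permutation.Setoid.Properties using (Unique-resp-↭)
open import Data.List.Sort using (sortingAlgorithm)
open import Data.List.Sort.Base using (SortingAlgorithm)
open import Data.List.Relation.Unary.Sorted.TotalOrder.Properties using (Sorted⇒AllPairs)
open import Relation.Binary using (DecTotalOrder)
open import Relation.Unary using (Decidable; Pred)
open import Relation.Nullary.Decidable using (_×-dec_; dec-true)
open import Data.Nat.DivMod using (m%n<n; m/n*n≤m; m≡m%n+[m/n]*n)
open import Data.Empty renaming (⊥ to Empty)
open import Data.Unit using (tt)
open import Data.Fin.Properties using (toℕ-injective)
open import Relation.Binary.Definitions using (tri<; tri>; tri≈)
import Data.Vec.Relation.Unary.All as VecAll
import Data.List.Relation.Unary.All.Properties as AllP
import Data.List.Relation.Unary.AllPairs.Properties as AllPairsP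
import Relation.Binary.Construct.On as On
import Algebra.Properties.CommutativeSemigroup as CommutativeSemigroup

-- Plain k-chains would not do: a coordinate has k + 1 places to enter a chain, so counting them
-- gives only k log m ≤ (1 + o(1)) d log(k + 1). A blow-up involves r k sets, while its exponent per
-- coordinate is r + log(k + 1); after division by r the logarithm of k disappears. The price is a
-- power r^k on the density of chains. That density is bounded below in terms of h and k alone, so
-- the price only raises the threshold for L, an integer with n 2^L ≤ m that stands in for log(m/n).
-- Two regimes come from rounding. For n ≤ R L the chain length follows n / L and stays bounded. For
-- n ≥ R L it is a fixed K and the number of blocks follows n / L instead. There a block has about K
-- D sets and may lose 2 D of them, so K has to be large compared with p for the loss to fit into
-- the factor 1 - 1/(p + 1).

module +-CS = CommutativeSemigroup +-commutativeSemigroup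
module *-CS = CommutativeSemigroup *-commutativeSemigroup

private variable
  ℓ : Level
  A B C : Set ℓ
  n : ℕ

-- Finite sums over lists.

∑ : List A → (A → ℕ) → ℕ
∑ []       f = 0
∑ (x ∷ xs) f = f x + ∑ xs f

∑-mono-∈ : ∀ (xs : List A) {f g} → (∀ {x} → x ∈ xs → f x ≤ g x) → ∑ xs f ≤ ∑ xs g
∑-mono-∈ []       f≤g = z≤n
∑-mono-∈ (x ∷ xs) f≤g = +-mono-≤ (f≤g (here refl)) (∑-mono-∈ xs (f≤g ∘ there))

∑-mono : ∀ (xs : List A) {f g} → (∀ x → f x ≤ g x) → ∑ xs f ≤ ∑ xs g
∑-mono xs f≤g = ∑-mono-∈ xs (λ {x} _ → f≤g x)

∑-cong : ∀ (xs : List A) {f g} → (∀ x → f x ≡ g x) → ∑ xs f ≡ ∑ xs g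
∑-cong []       f≡g = refl
∑-cong (x ∷ xs) f≡g = cong₂ _+_ (f≡g x) (∑-cong xs f≡g)

∑-+ : ∀ (xs : List A) f g → ∑ xs (λ x → f x + g x) ≡ ∑ xs f + ∑ xs g
∑-+ []       f g = refl
∑-+ (x ∷ xs) f g rewrite ∑-+ xs f g = +-CS.interchange (f x) (g x) (∑ xs f) (∑ xs g)

∑-*ˡ : ∀ (xs : List A) c f → ∑ xs (λ x → c * f x) ≡ c * ∑ xs f
∑-*ˡ []       c f = sym (*-zeroʳ c)
∑-*ˡ (x ∷ xs) c f rewrite ∑-*ˡ xs c f = sym (*-distribˡ-+ c (f x) _)

∑-*ʳ : ∀ (xs : List A) f c → ∑ xs (λ x → f x * c) ≡ ∑ xs f * c
∑-*ʳ []       f c = refl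
∑-*ʳ (x ∷ xs) f c rewrite ∑-*ʳ xs f c = sym (*-distribʳ-+ c (f x) _)

∑-const : ∀ (xs : List A) c → ∑ xs (λ _ → c) ≡ length xs * c
∑-const []       c = refl
∑-const (x ∷ xs) c = cong (c +_) (∑-const xs c)

∑-swap : ∀ (xs : List A) (ys : List B) (f : A → B → ℕ) →
         ∑ xs (λ x → ∑ ys (f x)) ≡ ∑ ys (λ y → ∑ xs (λ x → f x y))
∑-swap []       ys f = sym (trans (∑-const ys 0) (*-zeroʳ (length ys)))
∑-swap (x ∷ xs) ys f rewrite ∑-swap xs ys f = sym (∑-+ ys (f x) _)

∑-++ : ∀ (xs ys : List A) f → ∑ (xs ++ ys) f ≡ ∑ xs f + ∑ ys f
∑-++ []       ys f = refl
∑-++ (x ∷ xs) ys f rewrite ∑-++ xs ys f = sym (+-assoc (f x) _ _)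

∑-map : ∀ (h : A → B) xs f → ∑ (map h xs) f ≡ ∑ xs (f ∘ h)
∑-map h []       f = refl
∑-map h (x ∷ xs) f = cong (f (h x) +_) (∑-map h xs f)

∑-cartesianProductWith : ∀ (h : A → B → C) xs ys f →
  ∑ (cartesianProductWith h xs ys) f ≡ ∑ xs (λ x → ∑ ys (λ y → f (h x y)))
∑-cartesianProductWith h []       ys f = refl
∑-cartesianProductWith h (x ∷ xs) ys f
  rewrite ∑-++ (map (h x) ys) (cartesianProductWith h xs ys) f
  | ∑-map (h x) ys f | ∑-cartesianProductWith h xs ys f = refl

f∈≤∑ : ∀ {xs : List A} f {x} → x ∈ xs → f x ≤ ∑ xs f
f∈≤∑ f (here refl) = m≤m+n _ _
f∈≤∑ f (there x∈)  = ≤-trans (f∈≤∑ f x∈) (m≤n+m _ _)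

∑-∷-middle : ∀ (us : List A) x vs f → ∑ (us ++ x ∷ vs) f ≡ f x + ∑ (us ++ vs) f
∑-∷-middle us x vs f = begin
  ∑ (us ++ x ∷ vs) f        ≡⟨ ∑-++ us (x ∷ vs) f ⟩
  ∑ us f + (f x + ∑ vs f)   ≡⟨ +-CS.x∙yz≈y∙xz (∑ us f) (f x) (∑ vs f) ⟩
  f x + (∑ us f + ∑ vs f)   ≡⟨ cong (f x +_) (sym (∑-++ us vs f)) ⟩
  f x + ∑ (us ++ vs) f      ∎
  where
  open ≡-Reasoning

∑-⊆ : ∀ {xs ys : List A} f → Unique xs → (∀ {x} → x ∈ xs → x ∈ ys) → ∑ xs f ≤ ∑ ys f
∑-⊆ {xs = []}     f _           xs⊆ys = z≤n
∑-⊆ {xs = x ∷ xs} f (x∉ ∷ uniq) xs⊆ys with ∈-∃++ (xs⊆ys (here refl))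
... | us , vs , refl = begin
    f x + ∑ xs f          ≤⟨ +-monoʳ-≤ (f x) (∑-⊆ f uniq xs⊆us++vs) ⟩
    f x + ∑ (us ++ vs) f  ≡⟨ sym (∑-∷-middle us x vs f) ⟩
    ∑ (us ++ x ∷ vs) f    ∎
  where
  open ≤-Reasoning
  xs⊆us++vs : ∀ {y} → y ∈ xs → y ∈ us ++ vs
  xs⊆us++vs y∈ with ∈-++⁻ us (xs⊆ys (there y∈))
  ... | inj₁ y∈us         = ∈-++⁺ˡ y∈us
  ... | inj₂ (here refl)  = contradiction refl (All.lookup x∉ y∈)
  ... | inj₂ (there y∈vs) = ∈-++⁺ʳ us y∈vs

-- The power mean inequality.

-- This is (b - a)(b^p - a^p) ≥ 0, with the two differences as variables `d` and `e` so that no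
-- subtraction occurs.
rearrangement-≤ : ∀ {a b} p → a ≤ b → a * b ^ p + b * a ^ p ≤ a * a ^ p + b * b ^ p
rearrangement-≤ {a} p a≤b with m≤n⇒∃[o]m+o≡n a≤b | m≤n⇒∃[o]m+o≡n (^-monoˡ-≤ p a≤b)
... | d , refl | e , eq rewrite sym eq =
  subst (a * (a ^ p + e) + (a + d) * a ^ p ≤_) (lem a d (a ^ p) e) (m≤m+n _ _)
  where
  lem : ∀ a d c e → a * (c + e) + (a + d) * c + d * e ≡ a * c + (a + d) * (c + e)
  lem = solve-∀

rearrangement : ∀ a b p → a * b ^ p + b * a ^ p ≤ a * a ^ p + b * b ^ p
rearrangement a b p with ≤-total a b
... | inj₁ a≤b = rearrangement-≤ p a≤b
... | inj₂ b≤a = begin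
    a * b ^ p + b * a ^ p ≡⟨ +-comm (a * b ^ p) _ ⟩
    b * a ^ p + a * b ^ p ≤⟨ rearrangement-≤ p b≤a ⟩
    b * b ^ p + a * a ^ p ≡⟨ +-comm (b * b ^ p) _ ⟩
    a * a ^ p + b * b ^ p ∎
  where open ≤-Reasoning

-- Sum of `rearrangement` over pairs of entries: the induction pairs the head with each entry of the
-- tail.
chebyshev : ∀ (xs : List A) f p →
  ∑ xs f * ∑ xs (λ x → f x ^ p) ≤ length xs * ∑ xs (λ x → f x ^ suc p)
chebyshev []       f p = z≤n
chebyshev (x ∷ xs) f p = begin
    (f x + S) * (f x ^ p + T)
      ≡⟨ expand (f x) S (f x ^ p) T ⟩
    f x * f x ^ p + (f x * T + f x ^ p * S) + S * T
      ≤⟨ +-mono-≤ (+-monoʳ-≤ (f x * f x ^ p) cross) (chebyshev xs f p) ⟩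
    f x * f x ^ p + (N * (f x * f x ^ p) + U) + N * U
      ≡⟨ collect (f x * f x ^ p) N U ⟩
    suc N * (f x * f x ^ p + U) ∎
  where
  open ≤-Reasoning
  N = length xs
  S = ∑ xs f
  T = ∑ xs (λ y → f y ^ p)
  U = ∑ xs (λ y → f y ^ suc p)
  expand : ∀ a s b t → (a + s) * (b + t) ≡ a * b + (a * t + b * s) + s * t
  expand = solve-∀
  collect : ∀ c n u → c + (n * c + u) + n * u ≡ suc n * (c + u)
  collect = solve-∀
  cross : f x * T + f x ^ p * S ≤ N * (f x * f x ^ p) + U
  cross = begin
    f x * T + f x ^ p * S
      ≡⟨ cong₂ _+_ (sym (∑-*ˡ xs (f x) _)) (trans (*-comm (f x ^ p) S) (sym (∑-*ʳ xs f (f x ^ p)))) ⟩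
    ∑ xs (λ y → f x * f y ^ p) + ∑ xs (λ y → f y * f x ^ p)
      ≡⟨ sym (∑-+ xs _ _) ⟩
    ∑ xs (λ y → f x * f y ^ p + f y * f x ^ p)
      ≤⟨ ∑-mono xs (λ y → rearrangement (f x) (f y) p) ⟩
    ∑ xs (λ y → f x * f x ^ p + f y * f y ^ p)
      ≡⟨ ∑-+ xs _ _ ⟩
    ∑ xs (λ y → f x * f x ^ p) + U
      ≡⟨ cong (_+ U) (∑-const xs _) ⟩
    N * (f x * f x ^ p) + U ∎

-- Jensen's inequality for the p-th power, cleared of denominators; each factor of the power costs
-- one use of `chebyshev`.
power-mean : ∀ (xs : List A) f p →
  ∑ xs f ^ p * length xs ≤ length xs ^ p * ∑ xs (λ x → f x ^ p)
power-mean xs f zero = ≤-reflexive (trans (*-comm 1 _) (trans (sym (∑-const xs 1)) (sym (*-identityˡ _))))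
power-mean xs f (suc p) = begin
    ∑ xs f * ∑ xs f ^ p * N              ≡⟨ *-assoc (∑ xs f) _ N ⟩
    ∑ xs f * (∑ xs f ^ p * N)            ≤⟨ *-monoʳ-≤ (∑ xs f) (power-mean xs f p) ⟩
    ∑ xs f * (N ^ p * ∑ xs (λ x → f x ^ p)) ≡⟨ *-CS.x∙yz≈y∙xz (∑ xs f) (N ^ p) _ ⟩
    N ^ p * (∑ xs f * ∑ xs (λ x → f x ^ p)) ≤⟨ *-monoʳ-≤ (N ^ p) (chebyshev xs f p) ⟩
    N ^ p * (N * ∑ xs (λ x → f x ^ suc p))  ≡⟨ *-CS.x∙yz≈yx∙z (N ^ p) N _ ⟩
    N * N ^ p * ∑ xs (λ x → f x ^ suc p)    ∎
  where
  open ≤-Reasoning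
  N = length xs

-- Tuples, blow-ups and their convexity bound.

tuples : List A → ∀ k → List (Vec A k)
tuples xs zero    = [] ∷ []
tuples xs (suc k) = cartesianProductWith _∷_ xs (tuples xs k)

∑-tuples : ∀ (xs : List A) k f →
  ∑ (tuples xs (suc k)) f ≡ ∑ xs (λ x → ∑ (tuples xs k) (λ v → f (x ∷ v)))
∑-tuples xs k f = ∑-cartesianProductWith _∷_ xs (tuples xs k) f

length-∑ : ∀ (xs : List A) → length xs ≡ ∑ xs (λ _ → 1)
length-∑ xs = sym (trans (∑-const xs 1) (*-identityʳ _))

length-tuples : ∀ (xs : List A) k → length (tuples xs k) ≡ length xs ^ k
length-tuples xs zero    = refl
length-tuples xs (suc k) = begin
  length (tuples xs (suc k))              ≡⟨ length-∑ (tuples xs (suc k)) ⟩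
  ∑ (tuples xs (suc k)) (λ _ → 1)         ≡⟨ ∑-tuples xs k _ ⟩
  ∑ xs (λ _ → ∑ (tuples xs k) (λ _ → 1))  ≡⟨ ∑-const xs _ ⟩
  length xs * ∑ (tuples xs k) (λ _ → 1)   ≡⟨ cong (length xs *_) (sym (length-∑ (tuples xs k))) ⟩
  length xs * length (tuples xs k)        ≡⟨ cong (length xs *_) (length-tuples xs k) ⟩
  length xs * length xs ^ k               ∎
  where open ≡-Reasoning

∑-mono-tuples : ∀ (xs : List A) k {f g} →
  (∀ v → VecAll.All (_∈ xs) v → f v ≤ g v) → ∑ (tuples xs k) f ≤ ∑ (tuples xs k) g
∑-mono-tuples xs zero    f≤g = +-monoˡ-≤ 0 (f≤g [] VecAll.[])
∑-mono-tuples xs (suc k) {f} {g} f≤g = begin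
  ∑ (tuples xs (suc k)) f                          ≡⟨ ∑-tuples xs k f ⟩
  ∑ xs (λ x → ∑ (tuples xs k) (λ v → f (x ∷ v)))   ≤⟨ ∑-mono-∈ xs (λ x∈ → ∑-mono-tuples xs k (λ v v⊆ → f≤g _ (x∈ VecAll.∷ v⊆))) ⟩
  ∑ xs (λ x → ∑ (tuples xs k) (λ v → g (x ∷ v)))   ≡⟨ sym (∑-tuples xs k g) ⟩
  ∑ (tuples xs (suc k)) g ∎
  where open ≤-Reasoning

∏ : ∀ {k} → Vec A k → (A → ℕ) → ℕ
∏ []       f = 1
∏ (x ∷ xs) f = f x * ∏ xs f

∏-* : ∀ {k} (xs : Vec A k) f g → ∏ xs (λ x → f x * g x) ≡ ∏ xs f * ∏ xs g
∏-* []       f g = refl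
∏-* (x ∷ xs) f g rewrite ∏-* xs f g = *-CS.interchange (f x) (g x) (∏ xs f) (∏ xs g)

∏-const : ∀ {k} (xs : Vec A k) c → ∏ xs (λ _ → c) ≡ c ^ k
∏-const []       c = refl
∏-const (x ∷ xs) c = cong (c *_) (∏-const xs c)

∑-∏ : ∀ (xs : List A) k f → ∑ (tuples xs k) (λ v → ∏ v f) ≡ ∑ xs f ^ k
∑-∏ xs zero    f = refl
∑-∏ xs (suc k) f = trans (∑-tuples xs k _)
  (trans (∑-cong xs (λ x → trans (∑-*ˡ (tuples xs k) (f x) _) (cong (f x *_) (∑-∏ xs k f))))
         (∑-*ʳ xs f _))

*-distrib-^ : ∀ a b n → (a * b) ^ n ≡ a ^ n * b ^ n
*-distrib-^ a b zero    = refl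
*-distrib-^ a b (suc n) rewrite *-distrib-^ a b n = *-CS.interchange a b (a ^ n) (b ^ n)

-- For an indicator f, the number of complete k-partite configurations with r entries per class.
blowup : List A → ℕ → ∀ k → (Vec A k → ℕ) → ℕ
blowup xs r zero    f = f []
blowup xs r (suc k) f = ∑ (tuples xs r) (λ T → blowup xs r k (λ v → ∏ T (λ x → f (x ∷ v))))

-- In densities: if f has mean δ over k-tuples, its blow-up has mean at least δ^(r^k). Each class
-- uses convexity twice: over the remaining k-tuple, to replace one first entry by r of them, and
-- over the r-tuples `T`, to reach the power r^k that the induction needs for the link of `T`.
blowup-lower : ∀ (xs : List A) .{{_ : NonZero (length xs)}} r k f →
  ∑ (tuples xs k) f ^ (r ^ k) * length xs ^ (r * k) ≤
  blowup xs r k f * length xs ^ (k * r ^ k)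
blowup-lower xs r zero f rewrite *-zeroʳ r = ≤-reflexive (lem (f []))
  where
  lem : ∀ a → (a + 0) * 1 * 1 ≡ a * 1
  lem = solve-∀
blowup-lower {A = A} xs r (suc k) f =
  *-cancelʳ-≤ _ _ (N ^ (k * p)) {{m^n≢0 N (k * p)}} (begin
    S ^ (r * p) * N ^ (r * suc k) * N ^ (k * p)
      ≡⟨ cong (λ e → S ^ (r * p) * e * N ^ (k * p)) (trans (cong (N ^_) (*-suc r k)) (^-distribˡ-+-* N r (r * k))) ⟩
    S ^ (r * p) * (N ^ r * N ^ (r * k)) * N ^ (k * p)
      ≡⟨ cong₂ (λ s t → s * (N ^ r * N ^ (r * k)) * t) (sym (^-*-assoc S r p)) (sym (^-*-assoc N k p)) ⟩
    (S ^ r) ^ p * (N ^ r * N ^ (r * k)) * (N ^ k) ^ p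
      ≡⟨ lem₁ ((S ^ r) ^ p) (N ^ r) (N ^ (r * k)) ((N ^ k) ^ p) ⟩
    (S ^ r) ^ p * (N ^ k) ^ p * N ^ r * N ^ (r * k)
      ≡⟨ cong (λ e → e * N ^ r * N ^ (r * k)) (sym (*-distrib-^ (S ^ r) (N ^ k) p)) ⟩
    (S ^ r * N ^ k) ^ p * N ^ r * N ^ (r * k)
      ≤⟨ *-monoˡ-≤ (N ^ (r * k)) (*-monoˡ-≤ (N ^ r) (^-monoˡ-≤ p edges)) ⟩
    ((N ^ k) ^ r * W) ^ p * N ^ r * N ^ (r * k)
      ≡⟨ cong (λ e → e * N ^ r * N ^ (r * k)) (*-distrib-^ ((N ^ k) ^ r) W p) ⟩
    ((N ^ k) ^ r) ^ p * W ^ p * N ^ r * N ^ (r * k)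
      ≡⟨ cong (_* N ^ (r * k)) (*-assoc (((N ^ k) ^ r) ^ p) (W ^ p) (N ^ r)) ⟩
    ((N ^ k) ^ r) ^ p * (W ^ p * N ^ r) * N ^ (r * k)
      ≤⟨ *-monoˡ-≤ (N ^ (r * k)) (*-monoʳ-≤ (((N ^ k) ^ r) ^ p) links) ⟩
    ((N ^ k) ^ r) ^ p * ((N ^ r) ^ p * Q) * N ^ (r * k)
      ≡⟨ lem₂ (((N ^ k) ^ r) ^ p) ((N ^ r) ^ p) Q (N ^ (r * k)) ⟩
    ((N ^ k) ^ r) ^ p * (N ^ r) ^ p * (Q * N ^ (r * k))
      ≤⟨ *-monoʳ-≤ (((N ^ k) ^ r) ^ p * (N ^ r) ^ p) ih ⟩
    ((N ^ k) ^ r) ^ p * (N ^ r) ^ p * (B′ * N ^ (k * p))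
      ≡⟨ cong₂ (λ s t → s * t * (B′ * N ^ (k * p))) (trans (cong (_^ p) (^-*-assoc N k r)) (^-*-assoc N (k * r) p)) (^-*-assoc N r p) ⟩
    N ^ (k * r * p) * N ^ (r * p) * (B′ * N ^ (k * p))
      ≡⟨ cong (_* (B′ * N ^ (k * p))) (sym (^-distribˡ-+-* N (k * r * p) (r * p))) ⟩
    N ^ (k * r * p + r * p) * (B′ * N ^ (k * p))
      ≡⟨ cong (λ e → N ^ e * (B′ * N ^ (k * p))) (lem₃ k r p) ⟩
    N ^ (suc k * (r * p)) * (B′ * N ^ (k * p))
      ≡⟨ *-CS.x∙yz≈yx∙z (N ^ (suc k * (r * p))) B′ (N ^ (k * p)) ⟩
    B′ * N ^ (suc k * (r * p)) * N ^ (k * p) ∎)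
  where
  open ≤-Reasoning
  N = length xs
  p = r ^ k
  link : Vec A r → Vec A k → ℕ
  link T v = ∏ T (λ x → f (x ∷ v))
  S  = ∑ (tuples xs (suc k)) f
  W  = ∑ (tuples xs r) (λ T → ∑ (tuples xs k) (link T))
  Q  = ∑ (tuples xs r) (λ T → ∑ (tuples xs k) (link T) ^ p)
  B′ = blowup xs r (suc k) f
  lem₁ : ∀ a b c d → a * (b * c) * d ≡ a * d * b * c
  lem₁ = solve-∀
  lem₂ : ∀ a b c d → a * (b * c) * d ≡ a * b * (c * d)
  lem₂ = solve-∀
  lem₃ : ∀ k r p → k * r * p + r * p ≡ suc k * (r * p)
  lem₃ = solve-∀
  edges : S ^ r * N ^ k ≤ (N ^ k) ^ r * W
  edges = begin
    S ^ r * N ^ k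
      ≡⟨ cong₂ (λ s t → s ^ r * t) (trans (∑-tuples xs k f) (∑-swap xs (tuples xs k) (λ x v → f (x ∷ v)))) (sym (length-tuples xs k)) ⟩
    ∑ (tuples xs k) (λ v → ∑ xs (λ x → f (x ∷ v))) ^ r * length (tuples xs k)
      ≤⟨ power-mean (tuples xs k) _ r ⟩
    length (tuples xs k) ^ r * ∑ (tuples xs k) (λ v → ∑ xs (λ x → f (x ∷ v)) ^ r)
      ≡⟨ cong₂ (λ s t → s ^ r * t) (length-tuples xs k) (∑-cong (tuples xs k) (λ v → sym (∑-∏ xs r (λ x → f (x ∷ v))))) ⟩
    (N ^ k) ^ r * ∑ (tuples xs k) (λ v → ∑ (tuples xs r) (λ T → link T v))
      ≡⟨ cong ((N ^ k) ^ r *_) (∑-swap (tuples xs k) (tuples xs r) (λ v T → link T v)) ⟩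
    (N ^ k) ^ r * W ∎
  links : W ^ p * N ^ r ≤ (N ^ r) ^ p * Q
  links = subst (λ n → W ^ p * n ≤ n ^ p * Q) (length-tuples xs r) (power-mean (tuples xs r) _ p)
  ih : Q * N ^ (r * k) ≤ B′ * N ^ (k * p)
  ih = begin
    Q * N ^ (r * k)
      ≡⟨ sym (∑-*ʳ (tuples xs r) _ _) ⟩
    ∑ (tuples xs r) (λ T → ∑ (tuples xs k) (link T) ^ p * N ^ (r * k))
      ≤⟨ ∑-mono (tuples xs r) (λ T → blowup-lower xs r k (link T)) ⟩
    ∑ (tuples xs r) (λ T → blowup xs r k (link T) * N ^ (k * p))
      ≡⟨ ∑-*ʳ (tuples xs r) _ _ ⟩
    B′ * N ^ (k * p) ∎

∏-mono : ∀ {k} (xs : Vec A k) {f g} → (∀ x → f x ≤ g x) → ∏ xs f ≤ ∏ xs g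
∏-mono []       f≤g = ≤-refl
∏-mono (x ∷ xs) f≤g = *-mono-≤ (f≤g x) (∏-mono xs f≤g)

blowup-mono : ∀ (xs : List A) r k {f g} → (∀ v → f v ≤ g v) → blowup xs r k f ≤ blowup xs r k g
blowup-mono xs r zero    f≤g = f≤g []
blowup-mono xs r (suc k) {f} {g} f≤g = ∑-mono (tuples xs r) λ T →
  blowup-mono xs r k λ v → ∏-mono T (λ x → f≤g (x ∷ v))

c≤1⇒c^[1+r]≤c : ∀ {c} r → c ≤ 1 → c ^ suc r ≤ c
c≤1⇒c^[1+r]≤c r z≤n       = z≤n
c≤1⇒c^[1+r]≤c r (s≤s z≤n) = ≤-reflexive (^-zeroˡ (suc r))

-- A class turns c into `c ^ suc r`, which is at most c because c ≤ 1 and the exponent is positive.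
blowup-*ˡ : ∀ (xs : List A) r k {c} f → c ≤ 1 →
  blowup xs (suc r) k (λ v → c * f v) ≤ c * blowup xs (suc r) k f
blowup-*ˡ xs r zero    f c≤1 = ≤-refl
blowup-*ˡ xs r (suc k) {c} f c≤1 = begin
  ∑ Ts (λ T → blowup xs (suc r) k (λ v → ∏ T (λ x → c * f (x ∷ v))))
    ≤⟨ ∑-mono Ts (λ T → blowup-mono xs (suc r) k (λ v → pull T v)) ⟩
  ∑ Ts (λ T → blowup xs (suc r) k (λ v → c * ∏ T (λ x → f (x ∷ v))))
    ≤⟨ ∑-mono Ts (λ T → blowup-*ˡ xs r k _ c≤1) ⟩
  ∑ Ts (λ T → c * blowup xs (suc r) k (λ v → ∏ T (λ x → f (x ∷ v))))
    ≡⟨ ∑-*ˡ Ts c _ ⟩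
  c * blowup xs (suc r) (suc k) f ∎
  where
  open ≤-Reasoning
  Ts = tuples xs (suc r)
  pull : ∀ (T : Vec _ (suc r)) v → ∏ T (λ x → c * f (x ∷ v)) ≤ c * ∏ T (λ x → f (x ∷ v))
  pull T v = begin
    ∏ T (λ x → c * f (x ∷ v))               ≡⟨ ∏-* T (λ _ → c) _ ⟩
    ∏ T (λ _ → c) * ∏ T (λ x → f (x ∷ v))   ≡⟨ cong (_* ∏ T (λ x → f (x ∷ v))) (∏-const T c) ⟩
    c ^ suc r * ∏ T (λ x → f (x ∷ v))       ≤⟨ *-monoˡ-≤ (∏ T (λ x → f (x ∷ v))) (c≤1⇒c^[1+r]≤c r c≤1) ⟩
    c * ∏ T (λ x → f (x ∷ v))               ∎

-- Weighted inclusion in the Boolean lattice.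

-- ω α x y is α ^ ∣ y ∖ x ∣ when x ⊆ y and 0 otherwise; at α = 1 it is the zeta function of the
-- Boolean lattice, and α ↦ ω α turns addition into convolution (ω-convolution).
ω : ℕ → Subset n → Subset n → ℕ
ω α []            []            = 1
ω α (outside ∷ x) (outside ∷ y) = ω α x y
ω α (outside ∷ x) (inside  ∷ y) = α * ω α x y
ω α (inside  ∷ x) (outside ∷ y) = 0
ω α (inside  ∷ x) (inside  ∷ y) = ω α x y

sides : List Side
sides = outside ∷ inside ∷ []

subsets : ∀ n → List (Subset n)
subsets = tuples sides

∈-subsets : (x : Subset n) → x ∈ subsets n
∈-subsets []      = here refl
∈-subsets (s ∷ x) = ∈-cartesianProductWith⁺ _∷_ (∈-sides s) (∈-subsets x)
  where
  ∈-sides : ∀ s → s ∈ sides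
  ∈-sides outside = here refl
  ∈-sides inside  = there (here refl)

∑-subsets : ∀ (f : Subset (suc n) → ℕ) →
  ∑ (subsets (suc n)) f ≡ ∑ (subsets n) (f ∘ (outside ∷_)) + ∑ (subsets n) (f ∘ (inside ∷_))
∑-subsets {n} f = trans (∑-tuples sides n f) (cong (∑ (subsets n) (f ∘ (outside ∷_)) +_) (+-identityʳ _))

ω-convolution-∷ : ∀ α β (x y : Subset (suc n)) →
  ∑ (subsets (suc n)) (λ u → ω α x u * ω β u y) ≡
  ∑ (subsets n) (λ u → ω α x (outside ∷ u) * ω β (outside ∷ u) y) +
  ∑ (subsets n) (λ u → ω α x (inside ∷ u) * ω β (inside ∷ u) y)
ω-convolution-∷ α β x y = ∑-subsets (λ u → ω α x u * ω β u y)

∑-zero : ∀ (xs : List A) → ∑ xs (λ _ → 0) ≡ 0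
∑-zero xs = trans (∑-const xs 0) (*-zeroʳ (length xs))

-- Coordinate by coordinate. Only a coordinate in y but not in x leaves a choice: the intermediate u
-- contains it, with factor α, or does not, with factor β.
ω-convolution : ∀ α β (x y : Subset n) →
  ∑ (subsets n) (λ u → ω α x u * ω β u y) ≡ ω (α + β) x y
ω-convolution α β [] [] = refl
ω-convolution {suc n} α β (outside ∷ x) (outside ∷ y) = begin
  ∑ (subsets (suc n)) (λ u → ω α (outside ∷ x) u * ω β u (outside ∷ y))
    ≡⟨ ω-convolution-∷ α β (outside ∷ x) (outside ∷ y) ⟩
  _ + ∑ (subsets n) (λ u → α * ω α x u * 0)
    ≡⟨ cong₂ _+_ (ω-convolution α β x y) (trans (∑-cong (subsets n) (λ u → *-zeroʳ (α * ω α x u))) (∑-zero (subsets n))) ⟩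
  ω (α + β) x y + 0 ≡⟨ +-identityʳ _ ⟩
  ω (α + β) x y ∎
  where open ≡-Reasoning
ω-convolution {suc n} α β (outside ∷ x) (inside ∷ y) = begin
  ∑ (subsets (suc n)) (λ u → ω α (outside ∷ x) u * ω β u (inside ∷ y))
    ≡⟨ ω-convolution-∷ α β (outside ∷ x) (inside ∷ y) ⟩
  ∑ (subsets n) (λ u → ω α x u * (β * ω β u y)) + ∑ (subsets n) (λ u → α * ω α x u * ω β u y)
    ≡⟨ cong₂ _+_ (trans (∑-cong (subsets n) (λ u → *-CS.x∙yz≈y∙xz (ω α x u) β (ω β u y))) (∑-*ˡ (subsets n) β _))
                 (trans (∑-cong (subsets n) (λ u → *-assoc α (ω α x u) (ω β u y))) (∑-*ˡ (subsets n) α _)) ⟩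
  β * ∑ (subsets n) (λ u → ω α x u * ω β u y) + α * ∑ (subsets n) (λ u → ω α x u * ω β u y)
    ≡⟨ cong (λ s → β * s + α * s) (ω-convolution α β x y) ⟩
  β * ω (α + β) x y + α * ω (α + β) x y ≡⟨ lem' α β (ω (α + β) x y) ⟩
  (α + β) * ω (α + β) x y ∎
  where
  open ≡-Reasoning
  lem' : ∀ a b c → b * c + a * c ≡ (a + b) * c
  lem' = solve-∀
ω-convolution {suc n} α β (inside ∷ x) (outside ∷ y) = begin
  ∑ (subsets (suc n)) (λ u → ω α (inside ∷ x) u * ω β u (outside ∷ y))
    ≡⟨ ω-convolution-∷ α β (inside ∷ x) (outside ∷ y) ⟩
  ∑ (subsets n) (λ u → 0) + ∑ (subsets n) (λ u → ω α x u * 0)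
    ≡⟨ cong₂ _+_ (∑-zero (subsets n)) (trans (∑-cong (subsets n) (λ u → *-zeroʳ (ω α x u))) (∑-zero (subsets n))) ⟩
  0 ∎
  where open ≡-Reasoning
ω-convolution {suc n} α β (inside ∷ x) (inside ∷ y) = begin
  ∑ (subsets (suc n)) (λ u → ω α (inside ∷ x) u * ω β u (inside ∷ y))
    ≡⟨ ω-convolution-∷ α β (inside ∷ x) (inside ∷ y) ⟩
  ∑ (subsets n) (λ u → 0) + ∑ (subsets n) (λ u → ω α x u * ω β u y)
    ≡⟨ cong₂ _+_ (∑-zero (subsets n)) (ω-convolution α β x y) ⟩
  ω (α + β) x y ∎
  where open ≡-Reasoning

-- The exponent is a successor because 0 ^ 0 = 1 would break the case where x is not contained in y.
ω-^ : ∀ α r (x y : Subset n) → ω α x y ^ suc r ≡ ω (α ^ suc r) x y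
ω-^ α r []            []            = ^-zeroˡ (suc r)
ω-^ α r (outside ∷ x) (outside ∷ y) = ω-^ α r x y
ω-^ α r (outside ∷ x) (inside  ∷ y) = trans (*-distrib-^ α (ω α x y) (suc r)) (cong (α ^ suc r *_) (ω-^ α r x y))
ω-^ α r (inside  ∷ x) (outside ∷ y) = refl
ω-^ α r (inside  ∷ x) (inside  ∷ y) = ω-^ α r x y

ω-∪ : ∀ (x x′ y : Subset n) → ω 1 (x ∪ x′) y ≡ ω 1 x y * ω 1 x′ y
ω-∪ []            []             []            = refl
ω-∪ (outside ∷ x) (outside ∷ x′) (outside ∷ y) = ω-∪ x x′ y
ω-∪ (outside ∷ x) (outside ∷ x′) (inside  ∷ y)
  rewrite +-identityʳ (ω 1 (x ∪ x′) y) | +-identityʳ (ω 1 x y) | +-identityʳ (ω 1 x′ y) = ω-∪ x x′ y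
ω-∪ (outside ∷ x) (inside  ∷ x′) (outside ∷ y) = sym (*-zeroʳ (ω 1 x y))
ω-∪ (outside ∷ x) (inside  ∷ x′) (inside  ∷ y) rewrite +-identityʳ (ω 1 x y) = ω-∪ x x′ y
ω-∪ (inside  ∷ x) (s       ∷ x′) (outside ∷ y) = refl
ω-∪ (inside  ∷ x) (outside ∷ x′) (inside  ∷ y) rewrite +-identityʳ (ω 1 x′ y) = ω-∪ x x′ y
ω-∪ (inside  ∷ x) (inside  ∷ x′) (inside  ∷ y) = ω-∪ x x′ y

ω-⊥ : ∀ (y : Subset n) → ω 1 ⊥ y ≡ 1
ω-⊥ []            = refl
ω-⊥ (outside ∷ y) = ω-⊥ y
ω-⊥ (inside  ∷ y) = trans (+-identityʳ _) (ω-⊥ y)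

ω-refl : ∀ (x : Subset n) → ω 1 x x ≡ 1
ω-refl []            = refl
ω-refl (outside ∷ x) = ω-refl x
ω-refl (inside  ∷ x) = ω-refl x

⊆⇒ω≡1 : ∀ {x y : Subset n} → x ⊆ y → ω 1 x y ≡ 1
⊆⇒ω≡1 {x = []}          {[]}          _   = refl
⊆⇒ω≡1 {x = outside ∷ x} {outside ∷ y} x⊆y = ⊆⇒ω≡1 (drop-∷-⊆ x⊆y)
⊆⇒ω≡1 {x = outside ∷ x} {inside  ∷ y} x⊆y = trans (+-identityʳ _) (⊆⇒ω≡1 (drop-∷-⊆ x⊆y))
⊆⇒ω≡1 {x = inside  ∷ x} {outside ∷ y} x⊆y with x⊆y Vec.here
... | ()
⊆⇒ω≡1 {x = inside  ∷ x} {inside  ∷ y} x⊆y = ⊆⇒ω≡1 (drop-∷-⊆ x⊆y)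

ω≤1 : ∀ (x y : Subset n) → ω 1 x y ≤ 1
ω≤1 []            []            = ≤-refl
ω≤1 (outside ∷ x) (outside ∷ y) = ω≤1 x y
ω≤1 (outside ∷ x) (inside  ∷ y) = subst (_≤ 1) (sym (+-identityʳ _)) (ω≤1 x y)
ω≤1 (inside  ∷ x) (outside ∷ y) = z≤n
ω≤1 (inside  ∷ x) (inside  ∷ y) = ω≤1 x y

ω-mono : ∀ {α β} → α ≤ β → ∀ (x y : Subset n) → ω α x y ≤ ω β x y
ω-mono α≤β []            []            = ≤-refl
ω-mono α≤β (outside ∷ x) (outside ∷ y) = ω-mono α≤β x y
ω-mono α≤β (outside ∷ x) (inside  ∷ y) = *-mono-≤ α≤β (ω-mono α≤β x y)
ω-mono α≤β (inside  ∷ x) (outside ∷ y) = z≤n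
ω-mono α≤β (inside  ∷ x) (inside  ∷ y) = ω-mono α≤β x y

-- Product form of the weight α^(|y| - |x|), free of subtraction; the left side vanishes if x is not
-- contained in y.
ω-size : ∀ α (x y : Subset n) → ω α x y * α ^ ∣ x ∣ ≤ α ^ ∣ y ∣
ω-size α []            []            = ≤-refl
ω-size α (outside ∷ x) (outside ∷ y) = ω-size α x y
ω-size α (outside ∷ x) (inside  ∷ y) =
  subst (_≤ α * α ^ ∣ y ∣) (sym (*-assoc α (ω α x y) _)) (*-monoʳ-≤ α (ω-size α x y))
ω-size α (inside  ∷ x) (outside ∷ y) = z≤n
ω-size α (inside  ∷ x) (inside  ∷ y) =
  subst (_≤ α * α ^ ∣ y ∣) (*-CS.x∙yz≈y∙xz α (ω α x y) (α ^ ∣ x ∣)) (*-monoʳ-≤ α (ω-size α x y))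

-- Upper bound for blow-ups of chains.

⋃ᵛ : ∀ {r} → Vec (Subset n) r → Subset n
⋃ᵛ = Vec.foldr′ _∪_ ⊥

∏-ω : ∀ {r} (T : Vec (Subset n) r) y → ∏ T (λ x → ω 1 x y) ≡ ω 1 (⋃ᵛ T) y
∏-ω []      y = sym (ω-⊥ y)
∏-ω (x ∷ T) y = trans (cong (ω 1 x y *_) (∏-ω T y)) (sym (ω-∪ x (⋃ᵛ T) y))

-- The full interval is the convolution at α = β = 1, and distinct members of G use each of its
-- points at most once.
interval-size : ∀ {G : List (Subset n)} → Unique G → ∀ x y →
  ∑ G (λ u → ω 1 x u * ω 1 u y) ≤ ω 2 x y
interval-size {n} {G} uniq x y = begin
  ∑ G (λ u → ω 1 x u * ω 1 u y)           ≤⟨ ∑-⊆ _ uniq (λ {u} _ → ∈-subsets u) ⟩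
  ∑ (subsets n) (λ u → ω 1 x u * ω 1 u y) ≡⟨ ω-convolution 1 1 x y ⟩
  ω 2 x y                                 ∎
  where open ≤-Reasoning

-- Indicator of x ⊆ v₁ ⊆ ... ⊆ top. Inclusions are weak, so a set already in the chain can be
-- inserted again.
chain : ∀ {k} → Subset n → Subset n → Vec (Subset n) k → ℕ
chain top x []      = ω 1 x top
chain top x (y ∷ v) = ω 1 x y * chain top y v

chain≤1 : ∀ {k} top x (v : Vec (Subset n) k) → chain top x v ≤ 1
chain≤1 top x []      = ω≤1 x top
chain≤1 top x (y ∷ v) = *-mono-≤ (ω≤1 x y) (chain≤1 top y v)

-- The first set enters a chain only through its inclusion in the next one, so a tuple of first sets
-- acts like its union. The common tail occurs to the power `suc r`, and it is at most 1.
∏-chain : ∀ {r k} top (T : Vec (Subset n) (suc r)) (v : Vec (Subset n) k) →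
  ∏ T (λ x → chain top x v) ≤ chain top (⋃ᵛ T) v
∏-chain top T []      = ≤-reflexive (∏-ω T top)
∏-chain {r = r} top T (y ∷ v) = begin
  ∏ T (λ x → ω 1 x y * chain top y v)           ≡⟨ ∏-* T _ _ ⟩
  ∏ T (λ x → ω 1 x y) * ∏ T (λ _ → chain top y v) ≡⟨ cong₂ _*_ (∏-ω T y) (∏-const T _) ⟩
  ω 1 (⋃ᵛ T) y * chain top y v ^ suc r          ≤⟨ *-monoʳ-≤ (ω 1 (⋃ᵛ T) y) (c≤1⇒c^[1+r]≤c r (chain≤1 top y v)) ⟩
  ω 1 (⋃ᵛ T) y * chain top y v                  ∎
  where open ≤-Reasoning

-- The r-tuples of one class are summed according to their union, which separates them from the next class.
blowup-chain-upper : ∀ {G : List (Subset n)} → Unique G → ∀ r k top x →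
  blowup G (suc r) k (chain top x) ≤ ω (suc k * 2 ^ suc r) x top
-- The weight 1 is raised to `2 ^ suc r` so that every class adds the same amount under convolution.
blowup-chain-upper uniq r zero top x = ω-mono (subst (1 ≤_) (sym (+-identityʳ _)) (m^n>0 2 (suc r))) x top
blowup-chain-upper {n} {G} uniq r (suc k) top x = begin
  blowup G (suc r) (suc k) (chain top x)
    ≤⟨ ∑-mono Ts (λ T → step T) ⟩
  ∑ Ts (λ T → above T * g (⋃ᵛ T))
    -- Admitting every u that contains the entries of T, not only their union, makes the sum over T
    -- factor entrywise.
    ≤⟨ ∑-mono Ts (λ T → by-union T) ⟩
  ∑ Ts (λ T → ∑ Us (λ u → ∏ T (λ z → ω 1 x z * ω 1 z u) * g u))
    ≡⟨ ∑-swap Ts Us _ ⟩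
  ∑ Us (λ u → ∑ Ts (λ T → ∏ T (λ z → ω 1 x z * ω 1 z u) * g u))
    ≡⟨ ∑-cong Us (λ u → trans (∑-*ʳ Ts _ (g u)) (cong (_* g u) (∑-∏ G (suc r) _))) ⟩
  ∑ Us (λ u → ∑ G (λ z → ω 1 x z * ω 1 z u) ^ suc r * g u)
    ≤⟨ ∑-mono Us (λ u → *-monoˡ-≤ (g u) (^-monoˡ-≤ (suc r) (interval-size uniq x u))) ⟩
  ∑ Us (λ u → ω 2 x u ^ suc r * g u)
    ≡⟨ ∑-cong Us (λ u → cong (_* g u) (ω-^ 2 r x u)) ⟩
  ∑ Us (λ u → ω (2 ^ suc r) x u * g u)
    ≡⟨ ω-convolution (2 ^ suc r) (suc k * 2 ^ suc r) x top ⟩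
  ω (suc (suc k) * 2 ^ suc r) x top ∎
  where
  open ≤-Reasoning
  Ts = tuples G (suc r)
  Us = subsets n
  g : Subset n → ℕ
  g u = ω (suc k * 2 ^ suc r) u top
  above : Vec (Subset n) (suc r) → ℕ
  above T = ∏ T (λ z → ω 1 x z)
  above≤1 : ∀ T → above T ≤ 1
  above≤1 T = begin
    above T       ≤⟨ ∏-mono T (λ z → ω≤1 x z) ⟩
    ∏ T (λ _ → 1) ≡⟨ trans (∏-const T 1) (^-zeroˡ (suc r)) ⟩
    1             ∎
  step : ∀ T → blowup G (suc r) k (λ v → ∏ T (λ z → ω 1 x z * chain top z v)) ≤ above T * g (⋃ᵛ T)
  step T = begin
    blowup G (suc r) k (λ v → ∏ T (λ z → ω 1 x z * chain top z v))
      ≤⟨ blowup-mono G (suc r) k (λ v → ≤-trans (≤-reflexive (∏-* T _ _)) (*-monoʳ-≤ (above T) (∏-chain top T v))) ⟩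
    blowup G (suc r) k (λ v → above T * chain top (⋃ᵛ T) v)
      ≤⟨ blowup-*ˡ G r k _ (above≤1 T) ⟩
    above T * blowup G (suc r) k (chain top (⋃ᵛ T))
      ≤⟨ *-monoʳ-≤ (above T) (blowup-chain-upper uniq r k top (⋃ᵛ T)) ⟩
    above T * g (⋃ᵛ T) ∎
  by-union : ∀ T → above T * g (⋃ᵛ T) ≤ ∑ Us (λ u → ∏ T (λ z → ω 1 x z * ω 1 z u) * g u)
  by-union T = begin
    above T * g (⋃ᵛ T)
      ≡⟨ cong (_* g (⋃ᵛ T)) (sym (trans (∏-* T _ _) (trans (cong (above T *_) (trans (∏-ω T (⋃ᵛ T)) (ω-refl (⋃ᵛ T)))) (*-identityʳ (above T))))) ⟩
    ∏ T (λ z → ω 1 x z * ω 1 z (⋃ᵛ T)) * g (⋃ᵛ T)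
      ≤⟨ f∈≤∑ (λ u → ∏ T (λ z → ω 1 x z * ω 1 z u) * g u) (∈-subsets (⋃ᵛ T)) ⟩
    ∑ Us (λ u → ∏ T (λ z → ω 1 x z * ω 1 z u) * g u) ∎

-- Incomparability degrees and the number of chains.

incomp : Subset n → Subset n → ℕ
incomp x y = if does (incomparable? x y) then 1 else 0

incomp-sym : ∀ (x y : Subset n) → incomp x y ≡ incomp y x
incomp-sym x y with x ⊆? y | y ⊆? x
... | yes _ | yes _ = refl
... | yes _ | no  _ = refl
... | no  _ | yes _ = refl
... | no  _ | no  _ = refl

incomp-irrefl : ∀ (x : Subset n) → incomp x x ≡ 0
incomp-irrefl x with x ⊆? x
... | yes _  = refl
... | no x⊈x = contradiction (λ {i} → ⊆-refl {x = x} {i}) x⊈x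

trichotomy : ∀ (x y : Subset n) → x ⊆ y ⊎ y ⊆ x ⊎ incomp x y ≡ 1
trichotomy x y with x ⊆? y | y ⊆? x
... | yes x⊆y | _       = inj₁ x⊆y
... | no _    | yes y⊆x = inj₂ (inj₁ y⊆x)
... | no _    | no _    = inj₂ (inj₂ refl)

degree : List (Subset n) → Subset n → ℕ
degree G x = ∑ G (incomp x)

∑-insertions : ∀ {k} → (Vec A (suc k) → ℕ) → Vec A k → A → ℕ
∑-insertions f []      y = f (y ∷ [])
∑-insertions f (z ∷ v) y = f (y ∷ z ∷ v) + ∑-insertions (f ∘ (z ∷_)) v y

∑-insertions-cong : ∀ {k} {f g : Vec A (suc k) → ℕ} → (∀ w → f w ≡ g w) →
                    ∀ v y → ∑-insertions f v y ≡ ∑-insertions g v y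
∑-insertions-cong f≡g []      y = f≡g _
∑-insertions-cong f≡g (z ∷ v) y = cong₂ _+_ (f≡g _) (∑-insertions-cong (f≡g ∘ (z ∷_)) v y)

-- A (k + 1)-tuple arises from k + 1 insertions, one for each of its entries; the induction splits
-- off insertion in front.
∑-∑-insertions : ∀ (xs : List A) k f →
  ∑ (tuples xs k) (λ v → ∑ xs (∑-insertions f v)) ≡ suc k * ∑ (tuples xs (suc k)) f
∑-∑-insertions xs zero f = cong (_+ 0) (trans (∑-cong xs (λ x → sym (+-identityʳ _))) (sym (∑-tuples xs zero f)))
∑-∑-insertions xs (suc k) f = begin
  ∑ (tuples xs (suc k)) (λ v → ∑ xs (∑-insertions f v))
    ≡⟨ ∑-tuples xs k _ ⟩
  ∑ xs (λ z → ∑ (tuples xs k) (λ v → ∑ xs (λ y → f (y ∷ z ∷ v) + ∑-insertions (f ∘ (z ∷_)) v y)))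
    ≡⟨ ∑-cong xs (λ z → trans (∑-cong (tuples xs k) (λ v → ∑-+ xs _ _)) (∑-+ (tuples xs k) _ _)) ⟩
  ∑ xs (λ z → ∑ (tuples xs k) (λ v → ∑ xs (λ y → f (y ∷ z ∷ v)))
            + ∑ (tuples xs k) (λ v → ∑ xs (∑-insertions (f ∘ (z ∷_)) v)))
    ≡⟨ ∑-+ xs _ _ ⟩
  ∑ xs (λ z → ∑ (tuples xs k) (λ v → ∑ xs (λ y → f (y ∷ z ∷ v))))
    + ∑ xs (λ z → ∑ (tuples xs k) (λ v → ∑ xs (∑-insertions (f ∘ (z ∷_)) v)))
    ≡⟨ cong₂ _+_ front (trans (∑-cong xs (λ z → ∑-∑-insertions xs k (f ∘ (z ∷_)))) (∑-*ˡ xs (suc k) _)) ⟩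
  S + suc k * ∑ xs (λ z → ∑ (tuples xs (suc k)) (f ∘ (z ∷_)))
    ≡⟨ cong (λ s → S + suc k * s) (sym (∑-tuples xs (suc k) f)) ⟩
  suc (suc k) * S ∎
  where
  open ≡-Reasoning
  S = ∑ (tuples xs (suc (suc k))) f
  front : ∑ xs (λ z → ∑ (tuples xs k) (λ v → ∑ xs (λ y → f (y ∷ z ∷ v)))) ≡ S
  front = begin
    ∑ xs (λ z → ∑ (tuples xs k) (λ v → ∑ xs (λ y → f (y ∷ z ∷ v))))
      ≡⟨ ∑-cong xs (λ z → ∑-swap (tuples xs k) xs (λ v y → f (y ∷ z ∷ v))) ⟩
    ∑ xs (λ z → ∑ xs (λ y → ∑ (tuples xs k) (λ v → f (y ∷ z ∷ v))))
      ≡⟨ ∑-swap xs xs (λ z y → ∑ (tuples xs k) (λ v → f (y ∷ z ∷ v))) ⟩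
    ∑ xs (λ y → ∑ xs (λ z → ∑ (tuples xs k) (λ v → f (y ∷ z ∷ v))))
      ≡⟨ ∑-cong xs (λ y → sym (∑-tuples xs k (f ∘ (y ∷_)))) ⟩
    ∑ xs (λ y → ∑ (tuples xs (suc k)) (f ∘ (y ∷_)))
      ≡⟨ sym (∑-tuples xs (suc k) f) ⟩
    S ∎

-- Moving up the chain, y fits below the next set z, or contains z and is passed on, or is
-- incomparable to z. In the last case the first summand pays for the chain; otherwise x ⊆ y ⊆ top
-- ensures that y fits somewhere.
chain-insert : ∀ {k} top {x y : Subset n} (v : Vec (Subset n) k) → x ⊆ y → y ⊆ top →
  chain top x v ≤ chain top x v * ∑ (Vec.toList v) (λ z → incomp z y) + ∑-insertions (chain top x) v y
chain-insert top {x} {y} [] x⊆y y⊆top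
  rewrite ⊆⇒ω≡1 x⊆y | ⊆⇒ω≡1 y⊆top = ≤-trans (ω≤1 x top) (m≤n+m 1 _)
chain-insert {n} {suc k} top {x} {y} (z ∷ v) x⊆y y⊆top with ω 1 x z | ω≤1 x z
... | zero  | _       = z≤n
... | suc _ | s≤s z≤n = go (trichotomy z y)
  where
  open ≤-Reasoning
  c = chain top z v
  s = ∑ (Vec.toList v) (λ w → incomp w y)
  ins : (Vec (Subset n) (suc k) → ℕ) → ℕ
  ins f = ∑-insertions f v y
  first : ℕ
  first = ω 1 x y * (ω 1 y z * c)
  rest≡ : ins (λ w → 1 * chain top z w) ≡ ins (chain top z)
  rest≡ = ∑-insertions-cong (λ w → +-identityʳ _) v y
  go : z ⊆ y ⊎ y ⊆ z ⊎ incomp z y ≡ 1 →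
       c + 0 ≤ (c + 0) * (incomp z y + s) + (first + ins (λ w → 1 * chain top z w))
  go (inj₁ z⊆y) = begin
    c + 0               ≡⟨ +-identityʳ c ⟩
    c                   ≤⟨ chain-insert top v z⊆y y⊆top ⟩
    c * s + ins (chain top z) ≤⟨ +-mono-≤ (*-mono-≤ (m≤m+n c 0) (m≤n+m s (incomp z y))) (≤-trans (≤-reflexive (sym rest≡)) (m≤n+m _ first)) ⟩
    (c + 0) * (incomp z y + s) + (first + ins (λ w → 1 * chain top z w)) ∎
  go (inj₂ (inj₁ y⊆z)) = begin
    c + 0   ≡⟨ sym first≡ ⟩
    first   ≤⟨ ≤-trans (m≤m+n first _) (m≤n+m _ ((c + 0) * (incomp z y + s))) ⟩
    (c + 0) * (incomp z y + s) + (first + ins (λ w → 1 * chain top z w)) ∎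
    where
    first≡ : first ≡ c + 0
    first≡ rewrite ⊆⇒ω≡1 x⊆y | ⊆⇒ω≡1 y⊆z = +-identityʳ _
  go (inj₂ (inj₂ incomp≡1)) = begin
    c + 0                      ≤⟨ m≤m*n (c + 0) (suc s) ⟩
    (c + 0) * (1 + s)          ≡⟨ cong (λ i → (c + 0) * (i + s)) (sym incomp≡1) ⟩
    (c + 0) * (incomp z y + s) ≤⟨ m≤m+n _ _ ⟩
    (c + 0) * (incomp z y + s) + (first + ins (λ w → 1 * chain top z w)) ∎

chains : List (Subset n) → Subset n → Subset n → ℕ → ℕ
chains G bot top k = ∑ (tuples G k) (chain top bot)

module _ {G : List (Subset n)} {bot top : Subset n} {D : ℕ}
         (G⊆[bot,top] : ∀ {x} → x ∈ G → bot ⊆ x × x ⊆ top)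
         (degree≤D : ∀ {x} → x ∈ G → degree G x ≤ D) where

  private N = length G

  ∑-degree : ∀ {k} (v : Vec (Subset n) k) → VecAll.All (_∈ G) v → ∑ (Vec.toList v) (degree G) ≤ k * D
  ∑-degree []      VecAll.[]        = z≤n
  ∑-degree (x ∷ v) (x∈ VecAll.∷ v⊆) = +-mono-≤ (degree≤D x∈) (∑-degree v v⊆)

  -- Double counting of pairs of a k-chain and a set y: per chain at most k D sets are incomparable
  -- to a member, any other can be inserted, and each (k + 1)-chain is reached by k + 1 insertions.
  chains-step : ∀ k → N * chains G bot top k ≤ k * D * chains G bot top k + suc k * chains G bot top (suc k)
  chains-step k = begin
    N * chains G bot top k
      ≡⟨ sym (∑-*ˡ (tuples G k) N _) ⟩
    ∑ (tuples G k) (λ v → N * c v)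
      ≤⟨ ∑-mono-tuples G k extend ⟩
    ∑ (tuples G k) (λ v → k * D * c v + ∑ G (∑-insertions (chain top bot) v))
      ≡⟨ ∑-+ (tuples G k) _ _ ⟩
    ∑ (tuples G k) (λ v → k * D * c v) + ∑ (tuples G k) (λ v → ∑ G (∑-insertions (chain top bot) v))
      ≡⟨ cong₂ _+_ (∑-*ˡ (tuples G k) (k * D) _) (∑-∑-insertions G k (chain top bot)) ⟩
    k * D * chains G bot top k + suc k * chains G bot top (suc k) ∎
    where
    open ≤-Reasoning
    c : Vec (Subset n) k → ℕ
    c = chain top bot
    extend : ∀ v → VecAll.All (_∈ G) v → N * c v ≤ k * D * c v + ∑ G (∑-insertions (chain top bot) v)
    extend v v⊆ = begin
      N * c v
        ≡⟨ sym (∑-const G (c v)) ⟩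
      ∑ G (λ _ → c v)
        ≤⟨ ∑-mono-∈ G (λ y∈ → chain-insert top v (proj₁ (G⊆[bot,top] y∈)) (proj₂ (G⊆[bot,top] y∈))) ⟩
      ∑ G (λ y → c v * ∑ (Vec.toList v) (λ z → incomp z y) + ∑-insertions (chain top bot) v y)
        ≡⟨ ∑-+ G _ _ ⟩
      ∑ G (λ y → c v * ∑ (Vec.toList v) (λ z → incomp z y)) + ∑ G (∑-insertions (chain top bot) v)
        ≡⟨ cong (_+ ∑ G (∑-insertions (chain top bot) v)) (trans (∑-*ˡ G (c v) _) (cong (c v *_) (∑-swap G (Vec.toList v) (λ y z → incomp z y)))) ⟩
      c v * ∑ (Vec.toList v) (degree G) + ∑ G (∑-insertions (chain top bot) v)
        ≤⟨ +-monoˡ-≤ _ (≤-trans (*-monoʳ-≤ (c v) (∑-degree v v⊆)) (≤-reflexive (*-comm (c v) (k * D)))) ⟩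
      k * D * c v + ∑ G (∑-insertions (chain top bot) v) ∎

  -- For h > 0 the hypothesis reads k D ≤ (1 - 1/h) N, so at least N / h sets remain for insertion
  -- into a k-chain.
  chains-growth : ∀ h k → h * (k * D) + N ≤ h * N →
    N * chains G bot top k ≤ h * suc k * chains G bot top (suc k)
  chains-growth h k hkD+N≤hN = +-cancelˡ-≤ (h * (k * D) * c) _ _ (begin
    h * (k * D) * c + N * c              ≡⟨ sym (*-distribʳ-+ c (h * (k * D)) N) ⟩
    (h * (k * D) + N) * c                ≤⟨ *-monoˡ-≤ c hkD+N≤hN ⟩
    h * N * c                            ≡⟨ *-assoc h N c ⟩
    h * (N * c)                          ≤⟨ *-monoʳ-≤ h (chains-step k) ⟩
    h * (k * D * c + suc k * c′)         ≡⟨ lem h (k * D) c (suc k) c′ ⟩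
    h * (k * D) * c + h * suc k * c′     ∎)
    where
    open ≤-Reasoning
    c  = chains G bot top k
    c′ = chains G bot top (suc k)
    lem : ∀ a b c d e → a * (b * c + d * e) ≡ a * b * c + a * d * e
    lem = solve-∀

  chains-lower : ∀ h K k → h * (K * D) + N ≤ h * N → bot ⊆ top → k ≤ suc K →
    N ^ k ≤ (h * suc K) ^ k * chains G bot top k
  chains-lower h K zero    hyp bot⊆top k≤ rewrite ⊆⇒ω≡1 bot⊆top = ≤-refl
  chains-lower h K (suc k) hyp bot⊆top (s≤s k≤K) = begin
    N * N ^ k                                ≤⟨ *-monoʳ-≤ N (chains-lower h K k hyp bot⊆top (m≤n⇒m≤1+n k≤K)) ⟩
    N * (H ^ k * chains G bot top k)         ≡⟨ *-CS.x∙yz≈y∙xz N (H ^ k) _ ⟩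
    H ^ k * (N * chains G bot top k)         ≤⟨ *-monoʳ-≤ (H ^ k) (chains-growth h k (≤-trans (+-monoˡ-≤ N (*-monoʳ-≤ h (*-monoˡ-≤ D k≤K))) hyp)) ⟩
    H ^ k * (h * suc k * chains G bot top (suc k)) ≤⟨ *-monoʳ-≤ (H ^ k) (*-monoˡ-≤ (chains G bot top (suc k)) (*-monoʳ-≤ h (s≤s k≤K))) ⟩
    H ^ k * (H * chains G bot top (suc k))   ≡⟨ *-CS.x∙yz≈yx∙z (H ^ k) H _ ⟩
    H * H ^ k * chains G bot top (suc k)     ∎
    where
    open ≤-Reasoning
    H = h * suc K

  -- Chains have density at least 1 / (h k)^k with k = `suc K`; `blowup-lower` raises this to the
  -- power `suc r ^ k`. The loss depends on h, K and r, but not on N or the dimension.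
  chain-bound : .{{_ : NonZero N}} → Unique G → ∀ h K r → h * (K * D) + N ≤ h * N → bot ⊆ top →
    N ^ (suc r * suc K) ≤
    (h * suc K) ^ (suc K * suc r ^ suc K) * ω (suc (suc K) * 2 ^ suc r) bot top
  chain-bound uniq h K r hyp bot⊆top = *-cancelʳ-≤ _ _ (N ^ (k * p)) {{m^n≢0 N (k * p)}} (begin
    N ^ (suc r * k) * N ^ (k * p)
      ≡⟨ cong (N ^ (suc r * k) *_) (sym (^-*-assoc N k p)) ⟩
    N ^ (suc r * k) * (N ^ k) ^ p
      ≤⟨ *-monoʳ-≤ (N ^ (suc r * k)) (^-monoˡ-≤ p (chains-lower h K k hyp bot⊆top ≤-refl)) ⟩
    N ^ (suc r * k) * (H ^ k * c) ^ p
      ≡⟨ cong (N ^ (suc r * k) *_) (trans (*-distrib-^ (H ^ k) c p) (cong (_* c ^ p) (^-*-assoc H k p))) ⟩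
    N ^ (suc r * k) * (H ^ (k * p) * c ^ p)
      ≡⟨ *-CS.x∙yz≈y∙zx (N ^ (suc r * k)) (H ^ (k * p)) (c ^ p) ⟩
    H ^ (k * p) * (c ^ p * N ^ (suc r * k))
      ≤⟨ *-monoʳ-≤ (H ^ (k * p)) (blowup-lower G (suc r) k (chain top bot)) ⟩
    H ^ (k * p) * (blowup G (suc r) k (chain top bot) * N ^ (k * p))
      ≤⟨ *-monoʳ-≤ (H ^ (k * p)) (*-monoˡ-≤ (N ^ (k * p)) (blowup-chain-upper uniq r k top bot)) ⟩
    H ^ (k * p) * (ω (suc k * 2 ^ suc r) bot top * N ^ (k * p))
      ≡⟨ sym (*-assoc (H ^ (k * p)) _ _) ⟩
    H ^ (k * p) * ω (suc k * 2 ^ suc r) bot top * N ^ (k * p) ∎)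
    where
    open ≤-Reasoning
    k = suc K
    p = suc r ^ k
    H = h * k
    c = chains G bot top k

-- Comparison of exponents in an interval.

m<2^m : ∀ m → m < 2 ^ m
m<2^m zero    = ≤-refl
m<2^m (suc m) = begin
  1 + suc m       ≤⟨ +-mono-≤ (m^n>0 2 m) (m<2^m m) ⟩
  2 ^ m + 2 ^ m   ≡⟨ cong (2 ^ m +_) (sym (+-identityʳ _)) ⟩
  2 ^ suc m       ∎
  where open ≤-Reasoning

2^-cancel-≤ : ∀ {a b} → 2 ^ a ≤ 2 ^ b → a ≤ b
2^-cancel-≤ 2^a≤2^b = ≮⇒≥ (λ b<a → <⇒≱ (^-monoʳ-< 2 ≤-refl b<a) 2^a≤2^b)

ω≤α^d : ∀ α .{{_ : NonZero α}} {d} (x y : Subset n) → ∣ y ∣ ≤ d + ∣ x ∣ → ω α x y ≤ α ^ d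
ω≤α^d α {d} x y ∣y∣≤d+∣x∣ = *-cancelʳ-≤ _ _ (α ^ ∣ x ∣) {{m^n≢0 α ∣ x ∣}} (begin
  ω α x y * α ^ ∣ x ∣ ≤⟨ ω-size α x y ⟩
  α ^ ∣ y ∣           ≤⟨ ^-monoʳ-≤ α ∣y∣≤d+∣x∣ ⟩
  α ^ (d + ∣ x ∣)     ≡⟨ ^-distribˡ-+-* α d ∣ x ∣ ⟩
  α ^ d * α ^ ∣ x ∣   ∎)
  where open ≤-Reasoning

-- With k = K + 1 and N = length G: for N ≥ 2ᴸ sets in an interval of dimension d, the bounds
-- d ≤ (1 − 2/(P + 2)) k L and (k − 1) D ≤ (1 − 1/h) N are incompatible.
NoLongChains : (P h M L₀ : ℕ) → Set
NoLongChains P h M L₀ = ∀ {n} {G : List (Subset n)} {bot top D d K L} →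
  Unique G → (∀ {x} → x ∈ G → bot ⊆ x × x ⊆ top) → (∀ {x} → x ∈ G → degree G x ≤ D) →
  bot ⊆ top → ∣ top ∣ ≤ d + ∣ bot ∣ → K ≤ M → h * (K * D) + length G ≤ h * length G →
  L₀ ≤ L → 2 ^ L ≤ length G → ¬ ((2 + P) * d ≤ P * (suc K * L))

-- Blowing up by R = (P + 2) (M + 1) makes the factor K + 2 negligible against 2 ^ R.
no-long-chains-threshold : ∀ P h M → NoLongChains P h M (suc (h * suc M * ((2 + P) * suc M) ^ suc M))
no-long-chains-threshold P h M′ {n} {G} {bot} {top} {D} {d} {K} {L}
  uniq G⊆ deg≤ bot⊆top ∣top∣≤ K≤M′ hyp c<L 2^L≤N Qd≤PkL = <⇒≱ Qc≤ too-large
  where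
  Q = 2 + P
  M = suc M′
  -- Chosen so that `R` is `Q * M`; the factor M then cancels in `per-block`.
  r = M′ + suc P * M
  R = suc r
  c = h * M * R ^ M
  open ≤-Reasoning
  N = length G
  k = suc K
  k≤M : k ≤ M
  k≤M = s≤s K≤M′
  instance
    _ = >-nonZero (≤-trans (m^n>0 2 L) 2^L≤N)
  α = suc k * 2 ^ R
  instance
    α≢0 : NonZero α
    α≢0 = m*n≢0 (suc k) (2 ^ R) {{_}} {{m^n≢0 2 R}}
  α≤ : α ≤ 2 ^ (M + R)
  α≤ = begin
    suc k * 2 ^ R  ≤⟨ *-monoˡ-≤ (2 ^ R) (≤-trans (m<2^m k) (^-monoʳ-≤ 2 k≤M)) ⟩
    2 ^ M * 2 ^ R  ≡⟨ sym (^-distribˡ-+-* 2 M R) ⟩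
    2 ^ (M + R)    ∎
  H≤ : h * k ≤ 2 ^ (h * M)
  H≤ = ≤-trans (*-monoʳ-≤ h k≤M) (<⇒≤ (m<2^m (h * M)))
  kR^k≤ : k * R ^ k ≤ M * R ^ M
  kR^k≤ = *-mono-≤ k≤M (^-monoʳ-≤ R k≤M)
  exponents : L * (R * k) ≤ h * M * (M * R ^ M) + (M + R) * d
  exponents = 2^-cancel-≤ (begin
    2 ^ (L * (R * k))
      ≡⟨ sym (^-*-assoc 2 L (R * k)) ⟩
    (2 ^ L) ^ (R * k)
      ≤⟨ ^-monoˡ-≤ (R * k) 2^L≤N ⟩
    N ^ (R * k)
      ≤⟨ chain-bound G⊆ deg≤ uniq h K r hyp bot⊆top ⟩
    (h * k) ^ (k * R ^ k) * ω α bot top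
      ≤⟨ *-mono-≤ (^-monoˡ-≤ (k * R ^ k) H≤) (≤-trans (ω≤α^d α bot top ∣top∣≤) (^-monoˡ-≤ d α≤)) ⟩
    (2 ^ (h * M)) ^ (k * R ^ k) * (2 ^ (M + R)) ^ d
      ≡⟨ cong₂ _*_ (^-*-assoc 2 (h * M) (k * R ^ k)) (^-*-assoc 2 (M + R) d) ⟩
    2 ^ (h * M * (k * R ^ k)) * 2 ^ ((M + R) * d)
      ≤⟨ *-monoˡ-≤ (2 ^ ((M + R) * d)) (^-monoʳ-≤ 2 (*-monoʳ-≤ (h * M) kR^k≤)) ⟩
    2 ^ (h * M * (M * R ^ M)) * 2 ^ ((M + R) * d)
      ≡⟨ sym (^-distribˡ-+-* 2 (h * M * (M * R ^ M)) ((M + R) * d)) ⟩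
    2 ^ (h * M * (M * R ^ M) + (M + R) * d) ∎)
  per-block : Q * (L * k) ≤ c + (1 + Q) * d
  per-block = *-cancelʳ-≤ _ _ M (begin
    Q * (L * k) * M                          ≡⟨ lem₁ Q L k M ⟩
    L * (Q * M * k)                          ≤⟨ exponents ⟩
    h * M * (M * R ^ M) + (M + Q * M) * d    ≡⟨ lem₂ h M (R ^ M) Q d ⟩
    (c + (1 + Q) * d) * M                    ∎)
    where
    lem₁ : ∀ q l k m → q * (l * k) * m ≡ l * (q * m * k)
    lem₁ = solve-∀
    lem₂ : ∀ h m p q d → h * m * (m * p) + (m + q * m) * d ≡ (h * m * p + (1 + q) * d) * m
    lem₂ = solve-∀
  -- The blow-up costs a factor 1 + 1/Q, while the assumed bound on d has the factor 1 - 2/Q. The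
  -- margin is Q² - (Q + 1) P = P + 4.
  too-large : (4 + P) * (k * L) ≤ Q * c
  too-large = +-cancelʳ-≤ ((3 + P) * (P * (k * L))) _ _ (begin
    (4 + P) * (k * L) + (3 + P) * (P * (k * L))  ≡⟨ lem₁ P k L ⟩
    Q * (Q * (L * k))                            ≤⟨ *-monoʳ-≤ Q per-block ⟩
    Q * (c + (1 + Q) * d)                        ≡⟨ lem₂ Q c d ⟩
    Q * c + (1 + Q) * (Q * d)                    ≤⟨ +-monoʳ-≤ (Q * c) (*-monoʳ-≤ (1 + Q) Qd≤PkL) ⟩
    Q * c + (3 + P) * (P * (k * L))              ∎)
    where
    lem₁ : ∀ p k l → (4 + p) * (k * l) + (3 + p) * (p * (k * l)) ≡ (2 + p) * ((2 + p) * (l * k))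
    lem₁ = solve-∀
    lem₂ : ∀ q c d → q * (c + (1 + q) * d) ≡ q * c + (1 + q) * (q * d)
    lem₂ = solve-∀
  Qc≤ : Q * c < (4 + P) * (k * L)
  Qc≤ = begin-strict
    Q * c               <⟨ *-monoʳ-< Q c<L ⟩
    Q * L               ≤⟨ *-mono-≤ (m≤n+m Q 2) (m≤n*m L k) ⟩
    (4 + P) * (k * L)   ∎

-- Opaque, since the type checker would otherwise try to evaluate the threshold.
abstract
  no-long-chains : ∀ P h M → ∃ (NoLongChains P h M)
  no-long-chains P h M = _ , no-long-chains-threshold P h M

-- Flat blocks in a family sorted by size.

⊆∧∣≥∣⇒⊇ : ∀ {x y : Subset n} → x ⊆ y → ∣ y ∣ ≤ ∣ x ∣ → y ⊆ x
⊆∧∣≥∣⇒⊇ {x = []}          {[]}          x⊆y ∣y∣≤ = x⊆y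
⊆∧∣≥∣⇒⊇ {x = outside ∷ x} {outside ∷ y} x⊆y ∣y∣≤ = out⊆ (⊆∧∣≥∣⇒⊇ (drop-∷-⊆ x⊆y) ∣y∣≤)
⊆∧∣≥∣⇒⊇ {x = outside ∷ x} {inside  ∷ y} x⊆y ∣y∣≤ =
  contradiction (≤-trans ∣y∣≤ (p⊆q⇒∣p∣≤∣q∣ (drop-∷-⊆ x⊆y))) 1+n≰n
⊆∧∣≥∣⇒⊇ {x = inside  ∷ x} {outside ∷ y} x⊆y ∣y∣≤ with x⊆y Vec.here
... | ()
⊆∧∣≥∣⇒⊇ {x = inside  ∷ x} {inside  ∷ y} x⊆y (s≤s ∣y∣≤) = s⊆s (⊆∧∣≥∣⇒⊇ (drop-∷-⊆ x⊆y) ∣y∣≤)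

length-filter-∑ : ∀ {a p} {A : Set a} {P : Pred A p} (P? : Decidable P) xs →
  length (filter P? xs) ≡ ∑ xs (λ x → if does (P? x) then 1 else 0)
length-filter-∑ P? []       = refl
length-filter-∑ P? (x ∷ xs) with does (P? x)
... | true  = cong suc (length-filter-∑ P? xs)
... | false = length-filter-∑ P? xs

SizeSorted : List (Subset n) → Set
SizeSorted = AllPairs (λ x y → ∣ x ∣ ≤ ∣ y ∣)

sort-by-size : ∀ (G : List (Subset n)) → ∃ λ G′ → SizeSorted G′ × G′ ↭ G
sort-by-size {n} G = sort G , Sorted⇒AllPairs (DecTotalOrder.totalOrder order) (sort-↗ G) , sort-↭ G
  where
  order = On.decTotalOrder ≤-decTotalOrder (∣_∣ {n})
  open SortingAlgorithm (sortingAlgorithm order)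

take-below : ∀ s {x t : Subset n} {xs rest} → SizeSorted (x ∷ xs) → drop s (x ∷ xs) ≡ t ∷ rest →
  All (λ z → ∣ z ∣ ≤ ∣ t ∣) (take (suc s) (x ∷ xs))
take-below zero    _                      refl = ≤-refl ∷ []
take-below (suc s) {xs = []}     _        eq   with () ← trans (sym (drop-[] s)) eq
take-below (suc s) {xs = y ∷ xs} (x≤ ∷ sorted) eq =
  All.head (subst (All _) eq (AllP.drop⁺ s x≤)) ∷ take-below s sorted eq

-- Sizes are at most n, so they cannot increase by more than q in each of J steps of length s.
flat-block : ∀ J s q x (xs : List (Subset n)) {p} {P : Pred (Subset n) p} →
  SizeSorted (x ∷ xs) → Unique (x ∷ xs) → All P (x ∷ xs) →
  J * s ≤ length xs → n < ∣ x ∣ + J * suc q →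
  ∃₂ λ y t → ∃ λ ys → SizeSorted (y ∷ ys) × Unique (y ∷ ys) × All P (y ∷ ys) × P t ×
    length ys ≡ s × All (λ z → ∣ z ∣ ≤ ∣ t ∣) (y ∷ ys) × ∣ t ∣ ≤ q + ∣ y ∣
flat-block zero s q x xs _ _ _ _ n<∣x∣ =
  contradiction (∣p∣≤n x) (<⇒≱ (subst (_ <_) (+-identityʳ _) n<∣x∣))
flat-block {n} (suc J) s q x xs sorted uniq Pxs len n< with drop s (x ∷ xs) in eq
... | [] = contradiction (trans (sym (length-drop s (x ∷ xs))) (cong length eq)) (m>n⇒m∸n≢0 (s≤s (≤-trans (m≤m+n s (J * s)) len)))
... | t ∷ rest with ∣ t ∣ ≤? q + ∣ x ∣
...   | yes ∣t∣≤ = x , t , take s xs , AllPairsP.take⁺ (suc s) sorted , AllPairsP.take⁺ (suc s) uniq ,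
                   AllP.take⁺ (suc s) Pxs , All.head (subst (All _) eq (AllP.drop⁺ s Pxs)) ,
                   trans (length-take s xs) (m≤n⇒m⊓n≡m (≤-trans (m≤m+n s (J * s)) len)) ,
                   take-below s sorted eq , ∣t∣≤
...   | no  ∣t∣≰ = flat-block J s q t rest (subst (AllPairs _) eq (AllPairsP.drop⁺ s sorted))
                   (subst Unique eq (AllPairsP.drop⁺ s uniq)) (subst (All _) eq (AllP.drop⁺ s Pxs)) len′ n<′
  where
  open ≤-Reasoning
  len′ : J * s ≤ length rest
  len′ = ≤-pred (begin
    suc (J * s)              ≡⟨ cong suc (sym (m+n∸m≡n s (J * s))) ⟩
    suc (s + J * s ∸ s)      ≤⟨ s≤s (∸-monoˡ-≤ s len) ⟩
    suc (length xs ∸ s)      ≡⟨ sym (+-∸-assoc 1 (≤-trans (m≤m+n s (J * s)) len)) ⟩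
    suc (length xs) ∸ s      ≡⟨ sym (length-drop s (x ∷ xs)) ⟩
    length (drop s (x ∷ xs)) ≡⟨ cong length eq ⟩
    suc (length rest)        ∎)
  n<′ : n < ∣ t ∣ + J * suc q
  n<′ = begin-strict
    n                              <⟨ n< ⟩
    ∣ x ∣ + (suc q + J * suc q)    ≡⟨ lem ∣ x ∣ q (J * suc q) ⟩
    suc (q + ∣ x ∣) + J * suc q    ≤⟨ +-monoˡ-≤ (J * suc q) (≰⇒> ∣t∣≰) ⟩
    ∣ t ∣ + J * suc q              ∎
    where
    lem : ∀ a b c → a + (suc b + c) ≡ suc (b + a) + c
    lem = solve-∀

degree-⊆ : ∀ {G H : List (Subset n)} {x} → Unique G → (∀ {y} → y ∈ G → y ∈ H) → degree G x ≤ degree H x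
degree-⊆ uniq G⊆H = ∑-⊆ _ uniq G⊆H

-- Sizes in the block lie between those of its first and last set, so a member outside their
-- interval is incomparable to one of the two. Each of them accounts for at most D such members.
flat-interval : ∀ {G : List (Subset n)} {D} → Unique G → (∀ {x} → x ∈ G → degree G x ≤ D) →
  ∀ J s q → J * s < length G → n < J * suc q →
  ∃₂ λ bot top → ∃ λ G′ → Unique G′ × (∀ {x} → x ∈ G′ → bot ⊆ x × x ⊆ top) ×
    (∀ {x} → x ∈ G′ → degree G′ x ≤ D) × ∣ top ∣ ≤ q + ∣ bot ∣ × suc s ≤ length G′ + (D + D)
flat-interval {n} {G} {D} uniq deg≤ J s q Js<m n<Jq with sort-by-size G
... | [] , _ , p = contradiction (subst (J * s <_) (sym (↭-length p)) Js<m) λ()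
... | x ∷ xs , sorted , p
  with flat-block J s q x xs {P = _∈ G} sorted
         (Unique-resp-↭ (setoid _) (↭⇒↭ₛ (↭-sym p)) uniq)
         (All.tabulate (∈-resp-↭ p))
         (≤-pred (subst (J * s <_) (sym (↭-length p)) Js<m))
         (≤-trans n<Jq (m≤n+m _ ∣ x ∣))
... | bot , top , ys , sorted′ , uniq′ , ∈G , top∈G , refl , below , flat =
  bot , top , G′ , uniq″ , (λ x∈ → proj₂ (∈-filter⁻ between? {xs = block} x∈)) ,
  (λ {x} x∈ → ≤-trans (degree-⊆ {x = x} uniq″ (λ y∈ → G′⊆G y∈)) (deg≤ (G′⊆G x∈))) , flat , size
  where
  open ≤-Reasoning
  block = bot ∷ ys
  between? : Decidable (λ z → bot ⊆ z × z ⊆ top)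
  between? z = (bot ⊆? z) ×-dec (z ⊆? top)
  G′ = filter between? block
  uniq″ : Unique G′
  uniq″ = filter⁺ between? uniq′
  G′⊆G : ∀ {y} → y ∈ G′ → y ∈ G
  G′⊆G y∈ = All.lookup ∈G (proj₁ (∈-filter⁻ between? y∈))
  above : All (λ z → ∣ bot ∣ ≤ ∣ z ∣) block
  above = ≤-refl ∷ AllPairs.head sorted′
  inside? : Subset n → ℕ
  inside? z = if does (between? z) then 1 else 0
  between⇒1≤ : ∀ {z} m → bot ⊆ z → z ⊆ top → 1 ≤ inside? z + m
  between⇒1≤ {z} m bot⊆z z⊆top with bot ⊆? z | z ⊆? top
  ... | yes _    | yes _    = s≤s z≤n
  ... | yes _    | no z⊈top = contradiction (λ {i} → z⊆top {i}) z⊈top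
  ... | no bot⊈z | _        = contradiction (λ {i} → bot⊆z {i}) bot⊈z
  between-or-incomp : ∀ {z} → z ∈ block → 1 ≤ inside? z + (incomp bot z + incomp top z)
  between-or-incomp {z} z∈ with trichotomy bot z | trichotomy top z
  ... | inj₂ (inj₂ eq) | _ rewrite eq = ≤-trans (s≤s z≤n) (m≤n+m _ (inside? z))
  ... | inj₁ _         | inj₂ (inj₂ eq) rewrite eq = ≤-trans (m≤n+m 1 (incomp bot z)) (m≤n+m _ (inside? z))
  ... | inj₂ (inj₁ _)  | inj₂ (inj₂ eq) rewrite eq = ≤-trans (m≤n+m 1 (incomp bot z)) (m≤n+m _ (inside? z))
  -- An inclusion against the order of sizes is an equality.
  ... | inj₁ bot⊆z        | inj₁ top⊆z        = between⇒1≤ _ bot⊆z (⊆∧∣≥∣⇒⊇ top⊆z (All.lookup below z∈))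
  ... | inj₁ bot⊆z        | inj₂ (inj₁ z⊆top) = between⇒1≤ _ bot⊆z z⊆top
  ... | inj₂ (inj₁ z⊆bot) | inj₁ top⊆z        = between⇒1≤ _ (⊆∧∣≥∣⇒⊇ z⊆bot (All.lookup above z∈)) (⊆∧∣≥∣⇒⊇ top⊆z (All.lookup below z∈))
  ... | inj₂ (inj₁ z⊆bot) | inj₂ (inj₁ z⊆top) = between⇒1≤ _ (⊆∧∣≥∣⇒⊇ z⊆bot (All.lookup above z∈)) z⊆top
  size : suc (length ys) ≤ length G′ + (D + D)
  size = begin
    length block                                                  ≡⟨ length-∑ block ⟩
    ∑ block (λ _ → 1)                                             ≤⟨ ∑-mono-∈ block between-or-incomp ⟩
    ∑ block (λ z → inside? z + (incomp bot z + incomp top z))     ≡⟨ trans (∑-+ block inside? _) (cong (∑ block inside? +_) (∑-+ block (incomp bot) (incomp top))) ⟩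
    ∑ block inside? + (degree block bot + degree block top)
      ≤⟨ +-mono-≤ (≤-reflexive (sym (length-filter-∑ between? block)))
          (+-mono-≤ (≤-trans (degree-⊆ {x = bot} uniq′ (All.lookup ∈G)) (deg≤ (All.head ∈G)))
                    (≤-trans (degree-⊆ {x = top} uniq′ (All.lookup ∈G)) (deg≤ top∈G))) ⟩
    length G′ + (D + D) ∎

-- Lower bound for the maximum degree.

m<[1+m/n]*n : ∀ m n .{{_ : NonZero n}} → m < suc (m / n) * n
m<[1+m/n]*n m n = begin-strict
  m                   ≡⟨ m≡m%n+[m/n]*n m n ⟩
  m % n + m / n * n   <⟨ +-monoˡ-< (m / n * n) (m%n<n m n) ⟩
  n + m / n * n       ∎
  where open ≤-Reasoning

m+o≡n⇒m≤n : ∀ {m n} o → m + o ≡ n → m ≤ n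
m+o≡n⇒m≤n {m} o refl = m≤m+n m o

-- The excluded inequality says D ≤ (1 − 1/(p + 1)) L m / n for the maximum degree D of m sets.
module _ (p P k : ℕ) .{{_ : NonZero P}} where
  private
    a = suc p
    Q = 2 + P
    K = suc k
    R = P * K
    instance
      R≢0 : NonZero R
      R≢0 = m*n≢0 P K

  -- The whole cube serves as the interval. The chain length grows with n / L, and n ≤ R L bounds
  -- it, so one threshold serves for every n.
  max-degree-few-blocks : (∀ e m → P * (a * e) ≤ p * (Q * m) → 2 * a * e + m ≤ 2 * a * m) →
    ∃ λ L₀ → ∀ {n D L} {G : List (Subset n)} →
    Unique G → (∀ {x} → x ∈ G → degree G x ≤ D) → 1 ≤ n → n ≤ R * L → L₀ ≤ L → 1 ≤ L →
    n * 2 ^ L ≤ length G → ¬ (a * (n * D) ≤ p * (L * length G))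
  max-degree-few-blocks slack with no-long-chains P (2 * a) (Q * R)
  ... | L₀ , no-chains = L₀ , bound
    where
    bound : ∀ {n D L} {G : List (Subset n)} →
      Unique G → (∀ {x} → x ∈ G → degree G x ≤ D) → 1 ≤ n → n ≤ R * L → L₀ ≤ L → 1 ≤ L →
      n * 2 ^ L ≤ length G → ¬ (a * (n * D) ≤ p * (L * length G))
    bound {n} {D} {L} {G} uniq deg≤ 1≤n n≤RL L₀≤L 1≤L n2^L≤m sparse =
      no-chains {bot = ⊥} {top = ⊤} {d = n} {K = j} uniq (λ {x} _ → ⊆-min x , ⊆-max x) deg≤ (⊆-min ⊤)
        (≤-trans (∣p∣≤n (⊤ {n})) (m≤m+n n _)) j≤QR gap L₀≤L
        (≤-trans (m≤n*m (2 ^ L) n) n2^L≤m) Qn≤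
      where
      open ≤-Reasoning
      m = length G
      instance
        _ = >-nonZero 1≤n
        _ = >-nonZero 1≤L
      PL≢0 : NonZero (P * L)
      PL≢0 = m*n≢0 P L
      -- Rounded down: the degree condition involves j D, whereas the dimension condition involves
      -- the `suc j` sets of the chain.
      j = _/_ (Q * n) (P * L) {{PL≢0}}
      jPL≤Qn : j * (P * L) ≤ Q * n
      jPL≤Qn = m/n*n≤m (Q * n) (P * L) {{PL≢0}}
      Qn≤ : Q * n ≤ P * (suc j * L)
      Qn≤ = begin
        Q * n              ≤⟨ <⇒≤ (m<[1+m/n]*n (Q * n) (P * L) {{PL≢0}}) ⟩
        suc j * (P * L)    ≡⟨ *-CS.x∙yz≈y∙xz (suc j) P L ⟩
        P * (suc j * L)    ∎
      j≤QR : j ≤ Q * R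
      j≤QR = *-cancelʳ-≤ j (Q * R) L (begin
        j * L          ≤⟨ *-monoʳ-≤ j (m≤n*m L P) ⟩
        j * (P * L)    ≤⟨ jPL≤Qn ⟩
        Q * n          ≤⟨ *-monoʳ-≤ Q n≤RL ⟩
        Q * (R * L)    ≡⟨ sym (*-assoc Q R L) ⟩
        Q * R * L      ∎)
      PajD≤ : P * (a * (j * D)) ≤ p * (Q * m)
      PajD≤ = *-cancelʳ-≤ _ _ n (begin
        P * (a * (j * D)) * n     ≡⟨ lem₁ P a j D n ⟩
        P * j * (a * (n * D))     ≤⟨ *-monoʳ-≤ (P * j) sparse ⟩
        P * j * (p * (L * m))     ≡⟨ lem₂ P j p L m ⟩
        p * m * (j * (P * L))     ≤⟨ *-monoʳ-≤ (p * m) jPL≤Qn ⟩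
        p * m * (Q * n)           ≡⟨ lem₃ p m Q n ⟩
        p * (Q * m) * n           ∎)
        where
        lem₁ : ∀ P a j D n → P * (a * (j * D)) * n ≡ P * j * (a * (n * D))
        lem₁ = solve-∀
        lem₂ : ∀ P j p L m → P * j * (p * (L * m)) ≡ p * m * (j * (P * L))
        lem₂ = solve-∀
        lem₃ : ∀ p m Q n → p * m * (Q * n) ≡ p * (Q * m) * n
        lem₃ = solve-∀
      gap : 2 * a * (j * D) + m ≤ 2 * a * m
      gap = slack (j * D) m PajD≤

  -- With h = K the chain condition follows from K D ≤ N. `slack₁` makes a block large enough for K
  -- D plus the 2 D sets lost outside the interval; `slack₂` leaves at least 2^L sets after that
  -- loss.
  max-degree-many-blocks : p * (K + 2) * (Q + 1) ≤ R * a → (3 * p + 1) * (Q + 1) ≤ R * a →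
    ∃ λ L₀ → ∀ {n D L} {G : List (Subset n)} →
    Unique G → (∀ {x} → x ∈ G → degree G x ≤ D) → 1 ≤ n → R * L ≤ n → L₀ ≤ L → 1 ≤ L →
    n * 2 ^ L ≤ length G → ¬ (a * (n * D) ≤ p * (L * length G))
  max-degree-many-blocks slack₁ slack₂ with no-long-chains P K k
  ... | L₀ , no-chains = L₀ , bound
    where
    bound : ∀ {n D L} {G : List (Subset n)} →
      Unique G → (∀ {x} → x ∈ G → degree G x ≤ D) → 1 ≤ n → R * L ≤ n → L₀ ≤ L → 1 ≤ L →
      n * 2 ^ L ≤ length G → ¬ (a * (n * D) ≤ p * (L * length G))
    bound {n} {D} {L} {G} uniq deg≤ 1≤n RL≤n L₀≤L 1≤L n2^L≤m sparse = contra
      where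
      open ≤-Reasoning
      m = length G
      instance
        _ = >-nonZero 1≤n
        _ = >-nonZero 1≤L
      RL≢0 : NonZero (R * L)
      RL≢0 = m*n≢0 R L
      j = _/_ (Q * n) (R * L) {{RL≢0}}
      J = suc j
      -- J blocks of s + 1 sets, consecutive ones sharing a set; the flattest spans at most q levels.
      q = n / J
      s = (m ∸ 1) / J
      1≤m : 1 ≤ m
      1≤m = ≤-trans (≤-trans 1≤n (m≤m*n n (2 ^ L) {{m^n≢0 2 L}})) n2^L≤m
      -- Taking one block more than the quotient costs R L ≤ n, whence Q + 1 in place of Q.
      RJL≤ : R * (J * L) ≤ (Q + 1) * n
      RJL≤ = begin
        R * (J * L)           ≡⟨ lem R j L ⟩
        j * (R * L) + R * L   ≤⟨ +-mono-≤ (m/n*n≤m (Q * n) (R * L) {{RL≢0}}) RL≤n ⟩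
        Q * n + n             ≡⟨ lem′ Q n ⟩
        (Q + 1) * n           ∎
        where
        lem : ∀ r j l → r * (suc j * l) ≡ j * (r * l) + r * l
        lem = solve-∀
        lem′ : ∀ q n → q * n + n ≡ (q + 1) * n
        lem′ = solve-∀
      scaled : ∀ c → c * (Q + 1) ≤ R * a → c * (J * L) ≤ a * n
      scaled c c≤ = *-cancelˡ-≤ R (begin
        R * (c * (J * L))      ≡⟨ *-CS.x∙yz≈y∙xz R c (J * L) ⟩
        c * (R * (J * L))      ≤⟨ *-monoʳ-≤ c RJL≤ ⟩
        c * ((Q + 1) * n)      ≡⟨ sym (*-assoc c (Q + 1) n) ⟩
        c * (Q + 1) * n        ≤⟨ *-monoˡ-≤ n c≤ ⟩
        R * a * n              ≡⟨ *-assoc R a n ⟩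
        R * (a * n)            ∎)
      Qq≤ : Q * q ≤ P * (K * L)
      Qq≤ = *-cancelʳ-≤ _ _ J (begin
        Q * q * J          ≡⟨ *-assoc Q q J ⟩
        Q * (q * J)        ≤⟨ *-monoʳ-≤ Q (m/n*n≤m n J) ⟩
        Q * n              ≤⟨ <⇒≤ (m<[1+m/n]*n (Q * n) (R * L) {{RL≢0}}) ⟩
        J * (R * L)        ≡⟨ lem J P K L ⟩
        P * (K * L) * J    ∎)
        where
        lem : ∀ j p k l → j * (p * k * l) ≡ p * (k * l) * j
        lem = solve-∀
      Js<m : J * s < m
      Js<m = begin-strict
        J * s       ≡⟨ *-comm J s ⟩
        s * J       ≤⟨ m/n*n≤m (m ∸ 1) J ⟩
        m ∸ 1       <⟨ ∸-monoʳ-< {m} {1} {0} (s≤s z≤n) 1≤m ⟩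
        m           ∎
      m≤J[1+s] : m ≤ J * suc s
      m≤J[1+s] = begin
        m             ≡⟨ sym (m+[n∸m]≡n 1≤m) ⟩
        suc (m ∸ 1)   ≤⟨ m<[1+m/n]*n (m ∸ 1) J ⟩
        suc s * J     ≡⟨ *-comm (suc s) J ⟩
        J * suc s     ∎
      contra : Empty
      contra with flat-interval uniq deg≤ J s q Js<m (subst (n <_) (*-comm (suc q) J) (m<[1+m/n]*n n J))
      ... | bot , top , G′ , uniq′ , between , deg≤′ , flat , 1+s≤ =
        no-chains {K = k} uniq′ between deg≤′ (bot⊆top between 2^L≤N) flat ≤-refl gap L₀≤L 2^L≤N Qq≤
        where
        N = length G′
        m≤ : a * n * m ≤ a * n * (J * N) + 2 * (p * (J * L) * m)
        m≤ = begin
          a * n * m                                 ≤⟨ *-monoʳ-≤ (a * n) (≤-trans m≤J[1+s] (*-monoʳ-≤ J 1+s≤)) ⟩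
          a * n * (J * (N + (D + D)))               ≡⟨ lem₁ a n J N D ⟩
          a * n * (J * N) + 2 * J * (a * (n * D))   ≤⟨ +-monoʳ-≤ (a * n * (J * N)) (*-monoʳ-≤ (2 * J) sparse) ⟩
          a * n * (J * N) + 2 * J * (p * (L * m))   ≡⟨ lem₂ (a * n * (J * N)) J p L m ⟩
          a * n * (J * N) + 2 * (p * (J * L) * m)   ∎
          where
          lem₁ : ∀ a n j N D → a * n * (j * (N + (D + D))) ≡ a * n * (j * N) + 2 * j * (a * (n * D))
          lem₁ = solve-∀
          lem₂ : ∀ x j p l m → x + 2 * j * (p * (l * m)) ≡ x + 2 * (p * (j * l) * m)
          lem₂ = solve-∀
        KD≤N : K * D ≤ N
        KD≤N = *-cancelˡ-≤ (a * n * J) {{m*n≢0 (a * n) J {{m*n≢0 a n}}}} (+-cancelʳ-≤ (2 * (p * (J * L) * m)) _ _ (begin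
          a * n * J * (K * D) + 2 * (p * (J * L) * m)
            ≡⟨ cong (_+ 2 * (p * (J * L) * m)) (lem₁ a n J K D) ⟩
          J * K * (a * (n * D)) + 2 * (p * (J * L) * m)
            ≤⟨ +-monoˡ-≤ (2 * (p * (J * L) * m)) (*-monoʳ-≤ (J * K) sparse) ⟩
          J * K * (p * (L * m)) + 2 * (p * (J * L) * m)
            ≡⟨ lem₂ J K p L m ⟩
          p * (K + 2) * (J * L) * m
            ≤⟨ *-monoˡ-≤ m (scaled (p * (K + 2)) slack₁) ⟩
          a * n * m
            ≤⟨ m≤ ⟩
          a * n * (J * N) + 2 * (p * (J * L) * m)
            ≡⟨ cong (_+ 2 * (p * (J * L) * m)) (sym (*-assoc (a * n) J N)) ⟩
          a * n * J * N + 2 * (p * (J * L) * m) ∎))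
          where
          lem₁ : ∀ a n j k d → a * n * j * (k * d) ≡ j * k * (a * (n * d))
          lem₁ = solve-∀
          lem₂ : ∀ j k p l m → j * k * (p * (l * m)) + 2 * (p * (j * l) * m) ≡ p * (k + 2) * (j * l) * m
          lem₂ = solve-∀
        gap : K * (k * D) + N ≤ K * N
        gap = begin
          K * (k * D) + N   ≡⟨ lem K k D N ⟩
          N + k * (K * D)   ≤⟨ +-monoʳ-≤ N (*-monoʳ-≤ k KD≤N) ⟩
          K * N             ∎
          where
          lem : ∀ K k D N → K * (k * D) + N ≡ N + k * (K * D)
          lem = solve-∀
        2^L≤N : 2 ^ L ≤ N
        2^L≤N = *-cancelˡ-≤ (a * n * J) {{m*n≢0 (a * n) J {{m*n≢0 a n}}}} (+-cancelʳ-≤ (2 * (p * (J * L) * m)) _ _ (begin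
          a * n * J * 2 ^ L + 2 * (p * (J * L) * m)
            ≡⟨ cong (_+ 2 * (p * (J * L) * m)) (lem₁ a n J (2 ^ L)) ⟩
          a * J * (n * 2 ^ L) + 2 * (p * (J * L) * m)
            ≤⟨ +-monoˡ-≤ (2 * (p * (J * L) * m)) (*-mono-≤ (*-monoʳ-≤ a (m≤m*n J L)) n2^L≤m) ⟩
          a * (J * L) * m + 2 * (p * (J * L) * m)
            ≡⟨ lem₂ p (J * L) m ⟩
          (3 * p + 1) * (J * L) * m
            ≤⟨ *-monoˡ-≤ m (scaled (3 * p + 1) slack₂) ⟩
          a * n * m
            ≤⟨ m≤ ⟩
          a * n * (J * N) + 2 * (p * (J * L) * m)
            ≡⟨ cong (_+ 2 * (p * (J * L) * m)) (sym (*-assoc (a * n) J N)) ⟩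
          a * n * J * N + 2 * (p * (J * L) * m) ∎))
          where
          lem₁ : ∀ a n j e → a * n * j * e ≡ a * j * (n * e)
          lem₁ = solve-∀
          lem₂ : ∀ p e m → suc p * e * m + 2 * (p * e * m) ≡ (3 * p + 1) * e * m
          lem₂ = solve-∀
        bot⊆top : ∀ {G′ : List (Subset n)} → (∀ {x} → x ∈ G′ → bot ⊆ x × x ⊆ top) → 2 ^ L ≤ length G′ → bot ⊆ top
        bot⊆top {[]}     _       2^L≤0 = contradiction (≤-trans (m^n>0 2 L) 2^L≤0) λ()
        bot⊆top {x ∷ G′} between _     = ⊆-trans (proj₁ (between (here refl))) (proj₂ (between (here refl)))

  max-degree-generic : (∀ e m → P * (a * e) ≤ p * (Q * m) → 2 * a * e + m ≤ 2 * a * m) →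
    p * (K + 2) * (Q + 1) ≤ R * a → (3 * p + 1) * (Q + 1) ≤ R * a →
    ∃ λ L₀ → ∀ {n D L} {G : List (Subset n)} →
    Unique G → (∀ {x} → x ∈ G → degree G x ≤ D) → 1 ≤ n → L₀ ≤ L →
    n * 2 ^ L ≤ length G → p * (L * length G) < a * (n * D)
  -- The successor forces L ≥ 1; both regimes divide by multiples of L.
  max-degree-generic slack slack₁ slack₂ = suc (L₁ ⊔ L₂) , bound
    where
    few = max-degree-few-blocks slack
    many = max-degree-many-blocks slack₁ slack₂
    L₁ = proj₁ few
    L₂ = proj₁ many
    bound : ∀ {n D L} {G : List (Subset n)} →
      Unique G → (∀ {x} → x ∈ G → degree G x ≤ D) → 1 ≤ n → suc (L₁ ⊔ L₂) ≤ L →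
      n * 2 ^ L ≤ length G → p * (L * length G) < a * (n * D)
    bound {n} {L = L} uniq deg≤ 1≤n L₀<L n2^L≤m with ≤-total n (R * L)
    ... | inj₁ n≤RL = ≰⇒> (proj₂ few uniq deg≤ 1≤n n≤RL (≤-trans (m≤m⊔n L₁ L₂) (<⇒≤ L₀<L)) (≤-trans (s≤s z≤n) L₀<L) n2^L≤m)
    ... | inj₂ RL≤n = ≰⇒> (proj₂ many uniq deg≤ 1≤n RL≤n (≤-trans (m≤n⊔m L₁ L₂) (<⇒≤ L₀<L)) (≤-trans (s≤s z≤n) L₀<L) n2^L≤m)

-- With a = p + 1 and P = 4 a this is (1 + 2/P)(1 - 1/a) ≤ 1 - 1/(2 a), which fixes h = 2 a.
few-slack : ∀ p e m → 4 * suc p * (suc p * e) ≤ p * ((2 + 4 * suc p) * m) → 2 * suc p * e + m ≤ 2 * suc p * m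
few-slack p e m h = *-cancelˡ-≤ (2 * suc p) (begin
  2 * suc p * (2 * suc p * e + m)                  ≡⟨ lem p e m ⟩
  4 * suc p * (suc p * e) + 2 * suc p * m          ≤⟨ +-monoˡ-≤ (2 * suc p * m) h ⟩
  p * ((2 + 4 * suc p) * m) + 2 * suc p * m        ≤⟨ m+o≡n⇒m≤n (2 * m) (lem′ p m) ⟩
  2 * suc p * (2 * suc p * m)                      ∎)
  where
  open ≤-Reasoning
  lem : ∀ p e m → 2 * suc p * (2 * suc p * e + m) ≡ 4 * suc p * (suc p * e) + 2 * suc p * m
  lem = solve-∀
  lem′ : ∀ p m → p * ((2 + 4 * suc p) * m) + 2 * suc p * m + 2 * m ≡ 2 * suc p * (2 * suc p * m)
  lem′ = solve-∀

-- In effect (1 + 2/K)(1 + 3/P)(1 - 1/a) ≤ 1 for a = p + 1, P = 4 a and K = 8 a + 1, with the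
-- surplus explicit.
many-slack₁ : ∀ p → p * (suc (8 * suc p) + 2) * (2 + 4 * suc p + 1) + (27 * p + 36) ≡
             4 * suc p * suc (8 * suc p) * suc p
many-slack₁ = solve-∀

many-slack₂ : ∀ p → (3 * p + 1) * (2 + 4 * suc p + 1) + (32 * (p * p * p) + 88 * (p * p) + 79 * p + 29) ≡
             4 * suc p * suc (8 * suc p) * suc p
many-slack₂ = solve-∀

max-degree : ∀ p → ∃ λ L₀ → ∀ {n D L} {G : List (Subset n)} →
  Unique G → (∀ {x} → x ∈ G → degree G x ≤ D) → 1 ≤ n → L₀ ≤ L →
  n * 2 ^ L ≤ length G → p * (L * length G) < suc p * (n * D)
max-degree p = max-degree-generic p (4 * suc p) (8 * suc p) (few-slack p)
  (m+o≡n⇒m≤n (27 * p + 36) (many-slack₁ p))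
  (m+o≡n⇒m≤n (32 * (p * p * p) + 88 * (p * p) + 79 * p + 29) (many-slack₂ p))

-- Summation over successive removals.

∃-max : ∀ (f : A → ℕ) x xs → ∃ λ y → y ∈ x ∷ xs × (∀ {z} → z ∈ x ∷ xs → f z ≤ f y)
∃-max f x []        = x , here refl , λ { (here refl) → ≤-refl }
∃-max f x (x′ ∷ xs) with ∃-max f x′ xs
... | y , y∈ , max with ≤-total (f x) (f y)
...   | inj₁ fx≤fy = y , there y∈ , λ { (here refl) → fx≤fy ; (there z∈) → max z∈ }
...   | inj₂ fy≤fx = x , here refl , λ { (here refl) → ≤-refl ; (there z∈) → ≤-trans (max z∈) fy≤fx }

-- Each incomparable pair is counted twice.
degree-sum : List (Subset n) → ℕ
degree-sum G = ∑ G (degree G)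

-- Deleting x loses its own degree and, by symmetry, one from each set incomparable to it.
degree-sum-∷-middle : ∀ (us : List (Subset n)) x vs →
  degree-sum (us ++ x ∷ vs) ≡ degree-sum (us ++ vs) + 2 * degree (us ++ x ∷ vs) x
degree-sum-∷-middle us x vs = begin
  degree-sum G
    ≡⟨ ∑-∷-middle us x vs (degree G) ⟩
  degree G x + ∑ G′ (degree G)
    ≡⟨ cong (degree G x +_) (∑-cong G′ (λ y → ∑-∷-middle us x vs (incomp y))) ⟩
  degree G x + ∑ G′ (λ y → incomp y x + degree G′ y)
    ≡⟨ cong (degree G x +_) (∑-+ G′ (λ y → incomp y x) (degree G′)) ⟩
  degree G x + (∑ G′ (λ y → incomp y x) + degree-sum G′)
    ≡⟨ cong (λ d → degree G x + (d + degree-sum G′)) (trans (∑-cong G′ (λ y → incomp-sym y x)) (sym deg≡)) ⟩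
  degree G x + (degree G x + degree-sum G′)
    ≡⟨ lem (degree G x) (degree-sum G′) ⟩
  degree-sum G′ + 2 * degree G x ∎
  where
  open ≡-Reasoning
  G  = us ++ x ∷ vs
  G′ = us ++ vs
  deg≡ : degree G x ≡ degree G′ x
  deg≡ = trans (∑-∷-middle us x vs (incomp x)) (cong (_+ degree G′ x) (incomp-irrefl x))
  lem : ∀ a b → a + (a + b) ≡ b + 2 * a
  lem = solve-∀

-- Remove a set of maximum degree as long as more than n 2ᴸ sets are left.
degree-sum-lower : ∀ p → ∃ λ L₀ → ∀ {n L} → 1 ≤ n → L₀ ≤ L → ∀ {G : List (Subset n)} → Unique G →
  p * (L * (length G * length G)) ≤
  suc p * (n * degree-sum G) + p * (L * (n * 2 ^ L * (n * 2 ^ L)))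
degree-sum-lower p = proj₁ (max-degree p) , λ 1≤n L₀≤L {G} uniq → go 1≤n L₀≤L (length G) refl uniq
  where
  go : ∀ {n L} → 1 ≤ n → proj₁ (max-degree p) ≤ L → ∀ m {G : List (Subset n)} → length G ≡ m → Unique G →
    p * (L * (m * m)) ≤ suc p * (n * degree-sum G) + p * (L * (n * 2 ^ L * (n * 2 ^ L)))
  go {n} {L} 1≤n L₀≤L m {G} len uniq with ≤-total m (n * 2 ^ L)
  -- At or below the stopping size the error term alone suffices.
  ... | inj₁ m≤ = ≤-trans (*-monoʳ-≤ p (*-monoʳ-≤ L (*-mono-≤ m≤ m≤))) (m≤n+m _ _)
  go {n} {L} 1≤n L₀≤L m {[]} refl uniq | inj₂ _ rewrite *-zeroʳ L | *-zeroʳ p = z≤n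
  go {n} {L} 1≤n L₀≤L (suc m) {y ∷ ys} len uniq | inj₂ m₀≤m with ∃-max (degree (y ∷ ys)) y ys
  ... | x , x∈ , max with ∈-∃++ x∈
  ...   | us , vs , G≡ = begin
      p * (L * (suc m * suc m))
        -- By (m + 1)² ≤ m² + 2 (m + 1); the second summand is paid for by twice the degree removed.
        ≤⟨ m+o≡n⇒m≤n (p * L) (square p L m) ⟩
      p * (L * (m * m)) + 2 * (p * (L * suc m))
        ≤⟨ +-mono-≤ (go 1≤n L₀≤L m len′ uniq′) (*-monoʳ-≤ 2 (<⇒≤ big)) ⟩
      suc p * (n * e′) + rest + 2 * (suc p * (n * D))
        ≡⟨ collect (suc p) n e′ D rest ⟩
      suc p * (n * (e′ + 2 * D)) + rest
        ≡⟨ cong (λ e → suc p * (n * e) + rest) (sym e≡) ⟩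
      suc p * (n * degree-sum (y ∷ ys)) + rest ∎
    where
    open ≤-Reasoning
    rest = p * (L * (n * 2 ^ L * (n * 2 ^ L)))
    e′ = degree-sum (us ++ vs)
    D = degree (y ∷ ys) x
    e≡ : degree-sum (y ∷ ys) ≡ e′ + 2 * D
    e≡ = trans (cong degree-sum G≡) (trans (degree-sum-∷-middle us x vs) (cong (λ G → e′ + 2 * degree G x) (sym G≡)))
    len′ : length (us ++ vs) ≡ m
    len′ = suc-injective (trans (sym (length-++-sucʳ us x vs)) (trans (cong length (sym G≡)) len))
    uniq′ : Unique (us ++ vs)
    uniq′ = AllPairs.tail (Unique-resp-↭ (setoid _) (↭⇒↭ₛ (shift x us vs)) (subst Unique G≡ uniq))
    big : p * (L * suc m) < suc p * (n * D)
    big = subst (λ m → p * (L * m) < suc p * (n * D)) len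
            (proj₂ (max-degree p) uniq max 1≤n L₀≤L (subst (n * 2 ^ L ≤_) (sym len) m₀≤m))
    square : ∀ p l m → p * (l * (suc m * suc m)) + p * l ≡ p * (l * (m * m)) + 2 * (p * (l * suc m))
    square = solve-∀
    collect : ∀ a n e d r → a * (n * e) + r + 2 * (a * (n * d)) ≡ a * (n * (e + 2 * d)) + r
    collect = solve-∀

-- From degree sums to the logarithmic bound.

∑-concatMap : ∀ (h : A → List B) xs f → ∑ (concatMap h xs) f ≡ ∑ xs (λ x → ∑ (h x) f)
∑-concatMap h []       f = refl
∑-concatMap h (x ∷ xs) f = trans (∑-++ (h x) (concatMap h xs) f) (cong (∑ (h x) f +_) (∑-concatMap h xs f))

∑-filter : ∀ {p} {P : Pred A p} (P? : Decidable P) xs f →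
  ∑ (filter P? xs) f ≡ ∑ xs (λ x → if does (P? x) then f x else 0)
∑-filter P? []       f = refl
∑-filter P? (x ∷ xs) f with does (P? x)
... | true  = cong (f x +_) (∑-filter P? xs f)
... | false = ∑-filter P? xs f

degree-sum≤2iF : ∀ {n m} (F : Family n m) → degree-sum (map F (allFin m)) ≤ 2 * iF F
degree-sum≤2iF {n} {m} F = begin
  degree-sum (map F I)
    ≡⟨ trans (∑-map F I _) (∑-cong I (λ j → ∑-map F I (incomp (F j)))) ⟩
  ∑ I (λ j → ∑ I (λ k → incomp (F j) (F k)))
    ≤⟨ ∑-mono I (λ j → ∑-mono I (λ k → split j k)) ⟩
  ∑ I (λ j → ∑ I (λ k → ordered j k + ordered k j))
    ≡⟨ trans (∑-cong I (λ j → ∑-+ I (ordered j) (λ k → ordered k j))) (∑-+ I _ _) ⟩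
  S + ∑ I (λ j → ∑ I (λ k → ordered k j))
    ≡⟨ cong (S +_) (∑-swap I I (λ j k → ordered k j)) ⟩
  S + S
    ≡⟨ cong (S +_) (sym (+-identityʳ S)) ⟩
  2 * S
    ≡⟨ cong (2 *_) (sym iF≡) ⟩
  2 * iF F ∎
  where
  open ≤-Reasoning
  I = allFin m
  ordered : Fin m → Fin m → ℕ
  ordered j k = if does (toℕ j <? toℕ k) then incomp (F j) (F k) else 0
  S = ∑ I (λ j → ∑ I (ordered j))
  iF≡ : iF F ≡ S
  iF≡ = trans (length-filter-∑ _ (indexPairs m))
       (trans (∑-filter _ (concatMap (λ j → map (j ,_) I) I) _)
       (trans (∑-concatMap (λ j → map (j ,_) I) I _)
              (∑-cong I (λ j → ∑-map (j ,_) I _))))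
  split : ∀ j k → incomp (F j) (F k) ≤ ordered j k + ordered k j
  split j k with <-cmp (toℕ j) (toℕ k)
  ... | tri< j<k _ _ rewrite dec-true (toℕ j <? toℕ k) j<k = m≤m+n _ _
  ... | tri> _ _ k<j rewrite dec-true (toℕ k <? toℕ j) k<j = ≤-trans (≤-reflexive (incomp-sym (F j) (F k))) (m≤n+m _ _)
  ... | tri≈ _ j≡k _ rewrite toℕ-injective j≡k | incomp-irrefl (F k) = z≤n

-- The sum d + L is the integer part of log(m/n), in a form that carries its lower bound L. The
-- search ends within m steps because m < 2^m.
∃-⌊log₂⌋ : ∀ {n m} L → 1 ≤ n → n * 2 ^ L ≤ m → ∃ λ d → n * 2 ^ (d + L) ≤ m × m < n * 2 ^ suc (d + L)
∃-⌊log₂⌋ {n} {m} L 1≤n n2^L≤m = go m L n2^L≤m (≤-trans (m<2^m m) (≤-trans (^-monoʳ-≤ 2 (m≤m+n m L)) (m≤n*m _ n {{>-nonZero 1≤n}})))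
  where
  go : ∀ fuel L → n * 2 ^ L ≤ m → m < n * 2 ^ (fuel + L) →
       ∃ λ d → n * 2 ^ (d + L) ≤ m × m < n * 2 ^ suc (d + L)
  go zero       L lower upper = contradiction lower (<⇒≱ upper)
  go (suc fuel) L lower upper with n * 2 ^ suc L ≤? m
  ... | no  large = 0 , lower , ≰⇒> large
  ... | yes lower′ with go fuel (suc L) lower′ (subst (λ e → m < n * 2 ^ e) (sym (+-suc fuel L)) upper)
  ...   | d , l , u = suc d , subst (λ e → n * 2 ^ e ≤ m) (+-suc d L) l , subst (λ e → m < n * 2 ^ suc e) (+-suc d L) u

-- With b = c + 2, the factor c on the left leaves room for replacing L by L + b + 1 and for
-- dropping the term in m₀.
absorb-errors : ∀ c L m m₀ n e → let b = 2 + c in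
  b * b * (L * (m * m)) ≤ suc (b * b) * (n * e) + b * b * (L * (m₀ * m₀)) →
  b * m₀ ≤ m → b * suc b ≤ L → c * (suc (b + L) * (m * m)) ≤ b * (n * e)
absorb-errors c L m m₀ n e lower bm₀≤m bb≤L = *-cancelˡ-≤ (b * suc (b * b)) (begin
  b * suc (b * b) * (c * (suc (b + L) * (m * m)))
    ≡⟨ lem₁ b c L (m * m) ⟩
  c * suc (b * b) * ((b * suc b + b * L) * (m * m))
    ≤⟨ *-monoʳ-≤ (c * suc (b * b)) (*-monoˡ-≤ (m * m) (+-monoˡ-≤ (b * L) bb≤L)) ⟩
  c * suc (b * b) * ((L + b * L) * (m * m))
    ≤⟨ m+o≡n⇒m≤n ((c * c + 3 * c + 4) * (3 + c) * (L * (m * m))) (lem₂ c L (m * m)) ⟩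
  b * b * ((1 + c) * (3 + c) * (L * (m * m)))
    ≤⟨ *-monoʳ-≤ (b * b) main ⟩
  b * b * (suc (b * b) * (n * e))
    ≡⟨ lem₃ b (suc (b * b)) (n * e) ⟩
  b * suc (b * b) * (b * (n * e)) ∎)
  where
  open ≤-Reasoning
  b = 2 + c
  m₀-term : b * b * (L * (m₀ * m₀)) ≤ L * (m * m)
  m₀-term = begin
    b * b * (L * (m₀ * m₀))   ≡⟨ lem b L m₀ ⟩
    L * (b * m₀ * (b * m₀))   ≤⟨ *-monoʳ-≤ L (*-mono-≤ bm₀≤m bm₀≤m) ⟩
    L * (m * m)               ∎
    where
    lem : ∀ b l m → b * b * (l * (m * m)) ≡ l * (b * m * (b * m))
    lem = solve-∀
  -- Absorbing the m₀ term turns b² into b² - 1 = (1 + c)(3 + c).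
  main : (1 + c) * (3 + c) * (L * (m * m)) ≤ suc (b * b) * (n * e)
  main = +-cancelʳ-≤ (L * (m * m)) _ _ (begin
    (1 + c) * (3 + c) * (L * (m * m)) + L * (m * m)       ≡⟨ lem c (L * (m * m)) ⟩
    b * b * (L * (m * m))                                 ≤⟨ lower ⟩
    suc (b * b) * (n * e) + b * b * (L * (m₀ * m₀))       ≤⟨ +-monoʳ-≤ (suc (b * b) * (n * e)) m₀-term ⟩
    suc (b * b) * (n * e) + L * (m * m)                   ∎)
    where
    lem : ∀ c x → (1 + c) * (3 + c) * x + x ≡ (2 + c) * (2 + c) * x
    lem = solve-∀
  lem₁ : ∀ b c l x → b * suc (b * b) * (c * (suc (b + l) * x)) ≡ c * suc (b * b) * ((b * suc b + b * l) * x)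
  lem₁ = solve-∀
  -- c (b² + 1) ≤ b² (c + 1), multiplied by b + 1 = c + 3
  lem₂ : ∀ c l x → c * suc ((2 + c) * (2 + c)) * ((l + (2 + c) * l) * x) + (c * c + 3 * c + 4) * (3 + c) * (l * x)
                 ≡ (2 + c) * (2 + c) * ((1 + c) * (3 + c) * (l * x))
  lem₂ = solve-∀
  lem₃ : ∀ b s x → b * b * (s * x) ≡ b * s * (b * x)
  lem₃ = solve-∀

-- Passes to the exponentiated form of `LogBound`. Here log(m/n) is bounded from above, whereas the
-- degree bounds use a lower bound, so the rounding error has to be absorbed beforehand.
^-bound : ∀ {m n} L X Y → m ≤ n * 2 ^ L → L * X ≤ Y → m ^ X ≤ 2 ^ Y * n ^ X
^-bound {m} {n} L X Y m≤ LX≤Y = begin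
  m ^ X                  ≤⟨ ^-monoˡ-≤ X m≤ ⟩
  (n * 2 ^ L) ^ X        ≡⟨ *-distrib-^ n (2 ^ L) X ⟩
  n ^ X * (2 ^ L) ^ X    ≡⟨ cong (n ^ X *_) (^-*-assoc 2 L X) ⟩
  n ^ X * 2 ^ (L * X)    ≤⟨ *-monoʳ-≤ (n ^ X) (^-monoʳ-≤ 2 LX≤Y) ⟩
  n ^ X * 2 ^ Y          ≡⟨ *-comm (n ^ X) (2 ^ Y) ⟩
  2 ^ Y * n ^ X          ∎
  where open ≤-Reasoning

theorem1p6 : (a b : ℕ) → 0 < a → 0 < b →
    Σ ℕ λ ℓ₀ → Σ ℕ λ n₀ → 1 ≤ ℓ₀ × 1 ≤ n₀ ×
    ((n m : ℕ) → n₀ ≤ n → ℓ₀ * n ≤ m →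
    (F : Family n m) → Distinct F → LogBound (iF F) m n a b)
theorem1p6 a b 0<a 0<b = 2 ^ L₁ , 1 , m^n>0 2 L₁ , ≤-refl , bound
  where
  open ≤-Reasoning
  -- The choice p = b² makes the relative loss 1/(b² + 1), small against the available 2/b.
  L₀ = proj₁ (degree-sum-lower (b * b))
  -- The summands secure `b * m₀ ≤ m` (as b < 2^b), the threshold of `degree-sum-lower`, and
  -- `b * suc b ≤ L`.
  L₁ = b + (L₀ + b * suc b)
  bound : (n m : ℕ) → 1 ≤ n → 2 ^ L₁ * n ≤ m → (F : Family n m) → Distinct F → LogBound (iF F) m n a b
  bound n m 1≤n ℓn≤m F distinct with 2 * a ≤ᵇ b in eq
  -- For ε > 1/2 the coefficient is negative and n ≤ m suffices.
  ... | false = ≤-trans (^-monoˡ-≤ ((2 * a ∸ b) * (m * m)) n≤m) (m≤n*m _ (2 ^ (iF F * (2 * b * n))) {{m^n≢0 2 (iF F * (2 * b * n))}})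
    where
    n≤m : n ≤ m
    n≤m = ≤-trans (m≤n*m n (2 ^ L₁) {{m^n≢0 2 L₁}}) ℓn≤m
  ... | true with ∃-⌊log₂⌋ {n} {m} L₁ 1≤n (subst (_≤ m) (*-comm (2 ^ L₁) n) ℓn≤m)
  ...   | d , n2^L≤m , m<n2^[1+L] = ^-bound (suc (d + L₁)) X (iF F * (2 * b * n)) (<⇒≤ m<n2^[1+L]) exponent
    where
    X = (b ∸ 2 * a) * (m * m)
    G = map F (allFin m)
    e = degree-sum G
    -- This is b less than the integer part of log(m/n), so that removal stops at m₀ ≤ m / b.
    L = d + (L₀ + b * suc b)
    m₀ = n * 2 ^ L
    G-unique : Unique G
    G-unique = map⁺ distinct (allFin⁺ m)
    length-G : length G ≡ m
    length-G = trans (length-map F (allFin m)) (length-tabulate _)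
    2a≤b : 2 * a ≤ b
    2a≤b = ≤ᵇ⇒≤ (2 * a) b (subst Bool.T (sym eq) tt)
    2≤b : 2 ≤ b
    2≤b = ≤-trans (*-monoʳ-≤ 2 0<a) 2a≤b
    2+[b∸2]≡b : 2 + (b ∸ 2) ≡ b
    2+[b∸2]≡b = m+[n∸m]≡n 2≤b
    d+L₁≡b+L : d + L₁ ≡ b + L
    d+L₁≡b+L = +-CS.x∙yz≈y∙xz d b (L₀ + b * suc b)
    bm₀≤m : b * m₀ ≤ m
    bm₀≤m = begin
      b * (n * 2 ^ L)       ≤⟨ *-monoˡ-≤ (n * 2 ^ L) (<⇒≤ (m<2^m b)) ⟩
      2 ^ b * (n * 2 ^ L)   ≡⟨ *-CS.x∙yz≈y∙xz (2 ^ b) n (2 ^ L) ⟩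
      n * (2 ^ b * 2 ^ L)   ≡⟨ cong (n *_) (sym (^-distribˡ-+-* 2 b L)) ⟩
      n * 2 ^ (b + L)       ≡⟨ cong (λ l → n * 2 ^ l) (sym d+L₁≡b+L) ⟩
      n * 2 ^ (d + L₁)      ≤⟨ n2^L≤m ⟩
      m                     ∎
    lower : b * b * (L * (m * m)) ≤ suc (b * b) * (n * e) + b * b * (L * (m₀ * m₀))
    lower = subst (λ k → b * b * (L * (k * k)) ≤ suc (b * b) * (n * e) + b * b * (L * (m₀ * m₀))) length-G
      (proj₂ (degree-sum-lower (b * b)) 1≤n (≤-trans (m≤m+n L₀ _) (m≤n+m _ d)) G-unique)
    main : (b ∸ 2) * (suc (b + L) * (m * m)) ≤ b * (n * e)
    main = subst (λ b′ → b′ * b′ * (L * (m * m)) ≤ suc (b′ * b′) * (n * e) + b′ * b′ * (L * (m₀ * m₀)) →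
                         b′ * m₀ ≤ m → b′ * suc b′ ≤ L → (b ∸ 2) * (suc (b′ + L) * (m * m)) ≤ b′ * (n * e))
                 2+[b∸2]≡b (absorb-errors (b ∸ 2) L m m₀ n e)
                 lower bm₀≤m (≤-trans (m≤n+m _ L₀) (m≤n+m _ d))
    exponent : suc (d + L₁) * X ≤ iF F * (2 * b * n)
    exponent = begin
      suc (d + L₁) * X                      ≡⟨ cong (λ l → suc l * X) d+L₁≡b+L ⟩
      -- As a ≥ 1, the bound for ε = 1/b is the strongest one and implies the others.
      suc (b + L) * X                       ≤⟨ *-monoʳ-≤ (suc (b + L)) (*-monoˡ-≤ (m * m) (∸-monoʳ-≤ b (*-monoʳ-≤ 2 0<a))) ⟩
      suc (b + L) * ((b ∸ 2) * (m * m))     ≡⟨ *-CS.x∙yz≈y∙xz (suc (b + L)) (b ∸ 2) (m * m) ⟩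
      (b ∸ 2) * (suc (b + L) * (m * m))     ≤⟨ main ⟩
      b * (n * e)                           ≤⟨ *-monoʳ-≤ b (*-monoʳ-≤ n (degree-sum≤2iF F)) ⟩
      b * (n * (2 * iF F))                  ≡⟨ lem′ b n (iF F) ⟩
      iF F * (2 * b * n)                    ∎
      where
      lem′ : ∀ b n i → b * (n * (2 * i)) ≡ i * (2 * b * n)
      lem′ = solve-∀
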